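{- For every integer $n\ge 11$, $$\min\{f(P(n),M): M\in\mathcal{M}_1(P(n))\}=\left\lceil \frac{n+2}{6}\right\rceil .$$
   Context: For $n\ge 3$, $P(n)=P(n,2)$ is the simple graph with vertex set $\{u_i,v_i:0\le i\le n-1\}$ and edge set $\{u_iu_{i+2},\,u_iv_i,\,v_iv_{i+1}:0\le i\le n-1\}$, subscripts modulo $n$. The edges $u_iv_i$ are called spokes. For a perfect matching $M$ of a graph $G$, a forcing set of $M$ is a subset $S\subseteq M$ contained in no perfect matching of $G$ other than $M$; the forcing number $f(G,M)$ is the minimum cardinality of a forcing set of $M$. $\mathcal{M}_1(P(n))$ is the set of perfect matchings $M$ of $P(n)$ such that either (i) $M$ contains at least one spoke, and for any two (cyclically) consecutive spokes $u_iv_i,u_jv_j$ of $M$ the number of spokes $u_kv_k$ of $P(n)$ strictly between them, $j-i-1$ (with $j$ taken as the representative in $(i,i+n]$), is $\equiv 0\pmod 4$ (if $M$ has exactly one spoke $u_iv_i$, it is regarded as two consecutive spokes with $j=i+n$, so the number is $n-1$); or (ii) $M$ contains no spoke, $4\mid n$, and for some $i$, $M=\bigcup_{k=0}^{n/4-1}\{u_{i+4k}u_{i+4k+2},\,u_{i+4k+1}u_{i+4k+3},\,v_{i+4k}v_{i+4k+1},\,v_{i+4k+2}v_{i+4k+3}\}$. -}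

module Defs where

open import Data.Nat using (ℕ; zero; suc; _+_; _*_; _/_; _%_; _≤_; _<_; s≤s; z≤n)
open import Data.Nat.Properties using (≤-trans; +-assoc; +-comm)
open import Data.Nat.DivMod using (_mod_; m%n<n; m<n⇒m%n≡m; %-distribˡ-+; m%n%n≡m%n; [m+n]%n≡m%n)
open import Data.Nat.Divisibility using (_∣_)
open import Data.Fin using (Fin; toℕ; combine; remQuot)
open import Data.Fin.Patterns using (0F; 1F; 2F)
open import Data.Fin.Properties using (toℕ-fromℕ<; toℕ<n; toℕ-injective; combine-remQuot)
open import Data.Fin.Subset using (Subset; _∈_; _∉_; _⊆_; ∣_∣; _∪_; ⁅_⁆; ⋃)
open import Data.List using (map; upTo)
open import Data.Product using (∃; ∃!; _×_; _,_; proj₁; proj₂; uncurry)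
open import Data.Sum using (_⊎_)
open import Relation.Binary.PropositionalEquality

-- Graphs with numbered edges, so that a set of edges is a `Subset size` of the
-- standard library and its cardinality is `∣_∣`.
record Graph : Set₁ where
  field
    V    : Set
    size : ℕ
    ends : Fin size → V × V

  Edge : Set
  Edge = Fin size

  EdgeSet : Set
  EdgeSet = Subset size

  Incident : V → Edge → Set
  Incident x e = x ≡ proj₁ (ends e) ⊎ x ≡ proj₂ (ends e)

-- No loops, and an edge is determined by its unordered pair of endpoints.
record IsSimple (G : Graph) : Set where
  open Graph G
  field
    loopless : ∀ e → proj₁ (ends e) ≢ proj₂ (ends e)
    parallel : ∀ e e′ → ends e ≡ ends e′ → e ≡ e′
    opposite : ∀ e e′ → ends e ≡ (proj₂ (ends e′) , proj₁ (ends e′)) → e ≡ e′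

IsMinimum : (ℕ → Set) → ℕ → Set
IsMinimum A m = A m × (∀ k → A k → m ≤ k)

module _ (G : Graph) where
  open Graph G

  PerfectMatching : EdgeSet → Set
  PerfectMatching M = ∀ x → ∃! _≡_ λ e → e ∈ M × Incident x e

  IsForcingSet : EdgeSet → EdgeSet → Set
  IsForcingSet M S = S ⊆ M × (∀ M′ → PerfectMatching M′ → S ⊆ M′ → M′ ≡ M)

  -- f(G, M) = k
  IsForcingNumber : EdgeSet → ℕ → Set
  IsForcingNumber M = IsMinimum λ k → ∃ λ S → IsForcingSet M S × ∣ S ∣ ≡ k

-- Addition of an integer offset to a subscript modulo n.
infixl 6 _⊕_
_⊕_ : ∀ {n} → Fin n → ℕ → Fin n
_⊕_ {suc n} i k = (toℕ i + k) mod suc n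

data Vertex (n : ℕ) : Set where
  u v : Fin n → Vertex n

endpoints : ∀ {n} → Fin 3 × Fin n → Vertex n × Vertex n
endpoints (0F , i) = u i , u (i ⊕ 2)
endpoints (1F , i) = u i , v i
endpoints (2F , i) = v i , v (i ⊕ 1)

-- The generalized Petersen graph P(n, 2).  Its 3n edges are numbered through
-- Fin 3 × Fin n.  This numbering lists every edge once when n ≥ 5 (see
-- P-isSimple); at n = 4 the edges u₀u₂ and u₁u₃ would be listed twice.
P : ℕ → Graph
P n = record { V = Vertex n ; size = 3 * n ; ends = λ e → endpoints (remQuot n e) }

module _ {n : ℕ} where

  -- uu i = u_i u_{i+2},  spoke i = u_i v_i,  vv i = v_i v_{i+1}
  uu spoke vv : Fin n → Fin (3 * n)
  uu    = combine {3} 0F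
  spoke = combine {3} 1F
  vv    = combine {3} 2F

  -- The spokes of M at i and at j = i + d + 1 ∈ (i, i + n] are consecutive, with
  -- d spokes of P(n) strictly between them.  For d = n - 1 this says that the
  -- spoke at i is the only spoke of M.
  Consecutive : Subset (3 * n) → Fin n → ℕ → Set
  Consecutive M i d =
    d < n × spoke i ∈ M × spoke (i ⊕ suc d) ∈ M ×
    (∀ k → k < d → spoke (i ⊕ suc k) ∉ M)

  spokelessMatching : Fin n → Subset (3 * n)
  spokelessMatching i = ⋃ (map block (upTo (n / 4)))
    where
    block : ℕ → Subset (3 * n)
    block k = ⁅ uu (i ⊕ 4 * k) ⁆ ∪ ⁅ uu (i ⊕ (4 * k + 1)) ⁆
            ∪ ⁅ vv (i ⊕ 4 * k) ⁆ ∪ ⁅ vv (i ⊕ (4 * k + 2)) ⁆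

-- The class 𝓜₁(P(n)).
record 𝓜₁ (n : ℕ) (M : Subset (3 * n)) : Set where
  field
    perfect : PerfectMatching (P n) M
    shape   : ((∃ λ (i : Fin n) → spoke i ∈ M) ×
               (∀ (i : Fin n) d → Consecutive M i d → d % 4 ≡ 0))
            ⊎ ((∀ (i : Fin n) → spoke i ∉ M) ×
               4 ∣ n ×
               (∃ λ (i : Fin n) → M ≡ spokelessMatching i))

private
  toℕ-⊕ : ∀ {n} (i : Fin (suc n)) k → toℕ (i ⊕ k) ≡ (toℕ i + k) % suc n
  toℕ-⊕ {n} i k = toℕ-fromℕ< (m%n<n (toℕ i + k) (suc n))

  ⊕-⊕ : ∀ {n} (i : Fin n) j k → i ⊕ j ⊕ k ≡ i ⊕ (j + k)
  ⊕-⊕ {suc n} i j k = toℕ-injective (begin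
    toℕ (i ⊕ j ⊕ k)                              ≡⟨ toℕ-⊕ (i ⊕ j) k ⟩
    (toℕ (i ⊕ j) + k) % N                        ≡⟨ cong (λ a → (a + k) % N) (toℕ-⊕ i j) ⟩
    ((toℕ i + j) % N + k) % N                    ≡⟨ %-distribˡ-+ ((toℕ i + j) % N) k N ⟩
    ((toℕ i + j) % N % N + k % N) % N            ≡⟨ cong (λ a → (a + k % N) % N) (m%n%n≡m%n (toℕ i + j) N) ⟩
    ((toℕ i + j) % N + k % N) % N                ≡⟨ %-distribˡ-+ (toℕ i + j) k N ⟨
    (toℕ i + j + k) % N                          ≡⟨ cong (_% N) (+-assoc (toℕ i) j k) ⟩
    (toℕ i + (j + k)) % N                        ≡⟨ toℕ-⊕ i (j + k) ⟨
    toℕ (i ⊕ (j + k))                            ∎)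
    where
    open ≡-Reasoning
    N = suc n

  -- The offset r = n - i brings i ⊕ k to k and i to 0.
  ⊕-return : ∀ {n} (i : Fin (suc n)) k → k < suc n → ∃ λ r →
             toℕ (i ⊕ k ⊕ r) ≡ k × toℕ (i ⊕ r) ≡ 0
  ⊕-return {n} i k k<N = r , step k k<N , trans (cong (λ j → toℕ (j ⊕ r)) (sym i⊕0)) (step 0 (s≤s z≤n))
    where
    open import Data.Nat using (_∸_)
    open import Data.Nat.Properties using (m+[n∸m]≡n; <⇒≤; +-identityʳ)
    open ≡-Reasoning
    N = suc n
    r = N ∸ toℕ i
    i⊕0 : i ⊕ 0 ≡ i
    i⊕0 = toℕ-injective (trans (toℕ-⊕ i 0)
            (trans (cong (_% N) (+-identityʳ (toℕ i))) (m<n⇒m%n≡m (toℕ<n i))))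
    step : ∀ k → k < N → toℕ (i ⊕ k ⊕ r) ≡ k
    step k k<N = begin
      toℕ (i ⊕ k ⊕ r)          ≡⟨ cong toℕ (⊕-⊕ i k r) ⟩
      toℕ (i ⊕ (k + r))        ≡⟨ toℕ-⊕ i (k + r) ⟩
      (toℕ i + (k + r)) % N    ≡⟨ cong (λ a → (toℕ i + a) % N) (+-comm k r) ⟩
      (toℕ i + (r + k)) % N    ≡⟨ cong (_% N) (+-assoc (toℕ i) r k) ⟨
      (toℕ i + r + k) % N      ≡⟨ cong (λ a → (a + k) % N) (m+[n∸m]≡n (<⇒≤ (toℕ<n i))) ⟩
      (N + k) % N              ≡⟨ cong (_% N) (+-comm N k) ⟩
      (k + N) % N              ≡⟨ [m+n]%n≡m%n k N ⟩
      k % N                    ≡⟨ m<n⇒m%n≡m k<N ⟩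
      k                        ∎

  ⊕-moves : ∀ {n} (i : Fin n) k → suc k < n → i ⊕ suc k ≢ i
  ⊕-moves {suc n} i k k<n eq with r , p , q ← ⊕-return i (suc k) k<n
    with () ← trans (sym p) (trans (cong (λ j → toℕ (j ⊕ r)) eq) q)

  u-inj : ∀ {n} {i j : Fin n} → u i ≡ u j → i ≡ j
  u-inj refl = refl

  v-inj : ∀ {n} {i j : Fin n} → v i ≡ v j → i ≡ j
  v-inj refl = refl

P-isSimple : ∀ n → 5 ≤ n → IsSimple (P n)
P-isSimple n 5≤n = record
  { loopless = λ e → loopless (remQuot n e)
  ; parallel = λ e e′ eq → remQuot-inj (parallel _ _ eq)
  ; opposite = λ e e′ eq → remQuot-inj (opposite _ _ eq)
  }
  where
  remQuot-inj : {e e′ : Fin (3 * n)} → remQuot {3} n e ≡ remQuot n e′ → e ≡ e′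
  remQuot-inj {e} {e′} eq =
    trans (sym (combine-remQuot {3} n e)) (trans (cong (uncurry combine) eq) (combine-remQuot {3} n e′))

  loopless : (e : Fin 3 × Fin n) → proj₁ (endpoints e) ≢ proj₂ (endpoints e)
  loopless (0F , i) eq = ⊕-moves i 1 (≤-trans (s≤s (s≤s (s≤s z≤n))) 5≤n) (sym (u-inj eq))
  loopless (1F , i) ()
  loopless (2F , i) eq = ⊕-moves i 0 (≤-trans (s≤s (s≤s z≤n)) 5≤n) (sym (v-inj eq))

  parallel : (e e′ : Fin 3 × Fin n) → endpoints e ≡ endpoints e′ → e ≡ e′
  parallel (0F , i) (0F , j) eq = cong (0F ,_) (u-inj (cong proj₁ eq))
  parallel (0F , i) (1F , j) eq with () ← cong proj₂ eq
  parallel (0F , i) (2F , j) ()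
  parallel (1F , i) (0F , j) eq with () ← cong proj₂ eq
  parallel (1F , i) (1F , j) eq = cong (1F ,_) (u-inj (cong proj₁ eq))
  parallel (1F , i) (2F , j) ()
  parallel (2F , i) (0F , j) ()
  parallel (2F , i) (1F , j) ()
  parallel (2F , i) (2F , j) eq = cong (2F ,_) (v-inj (cong proj₁ eq))

  there-and-back : ∀ {i j : Fin n} a b → suc (a + b) < n → i ≡ j ⊕ suc a → i ⊕ b ≢ j
  there-and-back {j = j} a b small refl eq =
    ⊕-moves j (a + b) small (trans (sym (⊕-⊕ j (suc a) b)) eq)

  opposite : (e e′ : Fin 3 × Fin n) →
             endpoints e ≡ (proj₂ (endpoints e′) , proj₁ (endpoints e′)) → e ≡ e′
  opposite (0F , i) (0F , j) eq
    with () ← there-and-back 1 2 5≤n (u-inj (cong proj₁ eq)) (u-inj (cong proj₂ eq))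
  opposite (0F , i) (1F , j) ()
  opposite (0F , i) (2F , j) ()
  opposite (1F , i) (0F , j) eq with () ← cong proj₂ eq
  opposite (1F , i) (1F , j) ()
  opposite (1F , i) (2F , j) ()
  opposite (2F , i) (0F , j) ()
  opposite (2F , i) (1F , j) eq with () ← cong proj₂ eq
  opposite (2F , i) (2F , j) eq
    with () ← there-and-back 0 1 (≤-trans (s≤s (s≤s (s≤s z≤n))) 5≤n) (v-inj (cong proj₁ eq)) (v-inj (cong proj₂ eq))

{-# OPTIONS --safe #-}

-- Read around the cycle, a perfect matching of P(n) is a closed walk in an automaton with eight
-- states.  Its even half spells the cyclic tilings by spokes (length 1) and blocks (length 4), and
-- these are the matchings of 𝓜₁; its odd half spells all other perfect matchings.
--
-- Lower bound.  In a forcing set every block and every four consecutive spokes contain a hit, and a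
-- block with a single hit must not be able to slide by one or two places over unhit spokes.  Going
-- round the tiling with a potential ψ, each hit pays for six positions up to a nonnegative loss at
-- every tile, so 6 |S| ≥ n + total loss.  If the total loss is at most 1, the tiles are so
-- constrained that some odd closed walk also contains S; a finite exploration of the possible
-- histories confirms this.  Hence 6 |S| ≥ n + 2.
--
-- Upper bound.  One word for each n from 11 to 22 is extended by copies of a word of length 12 with
-- two hits; the set of states that competing walks can reach is unchanged by each copy.

module Submission where

open import Defs
import Data.Bool as Bool
open import Data.Bool using (Bool; true; false; _∧_; _∨_; T; not; _xor_; if_then_else_)
open import Data.Bool.ListAction using (all)
open import Data.Bool.Properties using (T-∧; T-∨)
open import Data.Empty using (⊥; ⊥-elim)
import Data.Fin as Fin
open import Data.Fin using (Fin; zero; suc; toℕ; combine; remQuot)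
open import Data.Fin.Patterns
open import Data.Fin.Properties using (toℕ-fromℕ<; toℕ<n; toℕ-injective; combine-remQuot;
  remQuot-combine; combine-injectiveˡ; combine-injectiveʳ)
open import Data.Fin.Subset using (Subset; _∈_; _∉_; _⊆_; ⋃) renaming (∣_∣ to ∥_∥)
open import Data.Fin.Subset.Properties using (x∈p∪q⁺; x∈⁅x⁆; ⊆-antisym)
import Data.List as List
open import Data.List using (List; []; _∷_; _++_; map; concatMap; length; foldl; mapMaybe; allFin;
  tabulate; upTo; applyUpTo)
open import Data.List.Membership.Propositional using () renaming (_∈_ to _∈ˡ_)
open import Data.List.Membership.Propositional.Properties using (∈-allFin)
open import Data.List.Properties using (++-assoc; ++-identityʳ; length-++; map-++; foldl-++; concatMap-++;
  map-tabulate; length-tabulate; tabulate-lookup; tabulate-cong; ∷-injectiveˡ)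
open import Data.List.Relation.Binary.Pointwise using (Pointwise; []; _∷_; tabulate⁺; tabulate⁻;
  Pointwise-length)
import Data.List.Relation.Unary.All as All
open import Data.List.Relation.Unary.All using (All; []; _∷_)
import Data.List.Relation.Unary.All.Properties as All
open import Data.List.Relation.Unary.Any using (here; there)
import Data.Maybe as Maybe
open import Data.Maybe using (Maybe; just; nothing; maybe)
import Data.Nat as ℕ
open import Data.Nat hiding (_≟_; parity) renaming (_/_ to _/ⁿ_)
open import Data.Nat.DivMod hiding (_div_; _/_)
open import Data.Nat.Divisibility using (divides; m%n≡0⇒n∣m)
open import Data.Nat.Properties hiding (_≟_)
open import Data.Nat.Solver using (module +-*-Solver)
open import Data.Product using (∃; ∃!; ∃₂; _×_; _,_; proj₁; proj₂)
open import Data.Product.Properties using () renaming (≡-dec to ×-≡-dec)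
open import Data.Sum using (_⊎_; inj₁; inj₂)
open import Data.Unit using (tt)
import Data.Vec as Vec
open import Data.Vec using (Vec; []; _∷_; zipWith; lookup; replicate; _[_]≔_)
open import Data.Vec.Properties using ([]=⇒lookup; lookup⇒[]=; lookup-concat; lookup∘tabulate; lookup∘update;
  lookup∘update′; lookup-replicate; lookup-zipWith; map-∘; map-cong; map-id) renaming (≡-dec to Vec-≡-dec)
open import Function using (_∘_)
open import Function.Bundles using (Equivalence)
open import Relation.Binary.Definitions using (DecidableEquality)
open import Relation.Binary.PropositionalEquality
open import Relation.Nullary using (¬_; yes; no; Dec)
open import Relation.Nullary.Decidable using (⌊_⌋; toWitness)

-- Retilings by slides involve the even half only, and the losses they force yield no more than 6
-- |S| ≥ n. The scan has a cycle without loss: three unhit spokes, a block that can slide right by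
-- two, an unhit spoke, a block that can slide left by two. That is 12 positions with two hits, and
-- ψ makes every tile of it balance exactly. What rules out repeating this cycle is the odd half.
-- The two hits are edges v_jv_{j+1} three positions apart, the length 12 is divisible by three, and
-- the odd tile of length 3 begins with such an edge, so copies of that tile alone run through all
-- the hits. This obstruction depends on the whole circle and not on a forbidden factor. The
-- exploration therefore remembers, for each odd starting state, the odd states reached so far; an
-- odd closed walk appears as a state reached from itself. A hit spoke or a block with two hits
-- already costs loss 2, so only five kinds of tiles occur in it. The same cycle serves as the
-- filler of the upper bound; the words for n from 11 to 22 supply the losses that stop the odd
-- walks.

-- The automaton of perfect matchings, and forcing as a property of closed walks

-- ⟨ a , s , b ⟩ records whether u_i u_{i+2}, u_i v_i and v_i v_{i+1} are chosen.
record Letter : Set where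
  constructor ⟨_,_,_⟩
  field uuᵇ spokeᵇ vvᵇ : Bool
open Letter public

pattern none = ⟨ false , false , false ⟩
pattern rim  = ⟨ true  , false , false ⟩
pattern rung = ⟨ false , true  , false ⟩
pattern path = ⟨ false , false , true  ⟩
pattern both = ⟨ true  , false , true  ⟩

-- ⟦ p , q , r ⟧ before position i records whether u_{i-2} u_i, u_{i-1} u_{i+1}
-- and v_{i-1} v_i are chosen.
record State : Set where
  constructor ⟦_,_,_⟧
  field p q r : Bool

pattern e₀ = ⟦ false , false , false ⟧
pattern e₁ = ⟦ false , true  , true  ⟧
pattern e₂ = ⟦ true  , true  , false ⟧
pattern e₃ = ⟦ true  , false , true  ⟧
pattern o₀ = ⟦ true  , false , false ⟧
pattern o₁ = ⟦ false , false , true  ⟧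
pattern o₂ = ⟦ false , true  , false ⟧
pattern o₃ = ⟦ true  , true  , true  ⟧

parity : State → Bool
parity ⟦ p , q , r ⟧ = p xor (q xor r)

-- The even states spell tiles of lengths 1 and 4, the odd states tiles of lengths 3 and 4.
data Step : State → Letter → State → Set where
  e₀-rung : Step e₀ rung e₀
  e₀-both : Step e₀ both e₁
  e₁-rim  : Step e₁ rim  e₂
  e₂-path : Step e₂ path e₃
  e₃-none : Step e₃ none e₀
  o₀-path : Step o₀ path o₁
  o₁-rim  : Step o₁ rim  o₂
  o₂-rung : Step o₂ rung o₀
  o₂-both : Step o₂ both o₃
  o₃-none : Step o₃ none o₀

infixr 5 _∷_ _++ʷ_
data Walk : State → List Letter → State → Set where
  []  : ∀ {s} → Walk s [] s
  _∷_ : ∀ {s l t w r} → Step s l t → Walk t w r → Walk s (l ∷ w) r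

_++ʷ_ : ∀ {s t r x y} → Walk s x t → Walk t y r → Walk s (x ++ y) r
[]      ++ʷ b = b
(a ∷ x) ++ʷ b = a ∷ (x ++ʷ b)

splitʷ : ∀ {s r} x {y} → Walk s (x ++ y) r → ∃ λ t → Walk s x t × Walk t y r
splitʷ []      w       = _ , [] , w
splitʷ (l ∷ x) (a ∷ w) with t , b , c ← splitʷ x w = t , a ∷ b , c

Closed : List Letter → Set
Closed w = ∃ λ s → Walk s w s

imp : Bool → Bool → Bool
imp true  b = b
imp false _ = true

infix 7 _⊑ᵇ_
infix 4 _⊑_
_⊑ᵇ_ : Letter → Letter → Bool
⟨ a , s , b ⟩ ⊑ᵇ ⟨ a′ , s′ , b′ ⟩ = imp a a′ ∧ imp s s′ ∧ imp b b′

_⊑_ : Letter → Letter → Set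
h ⊑ l = T (h ⊑ᵇ l)

-- One position of a matching with a set of hit edges: the hit edges, then all matching edges.
Cell : Set
Cell = Letter × Letter

marks : List Cell → List Letter
marks = map proj₂

Compat Exact : Cell → Letter → Set
Compat (h , _) l = h ⊑ l
Exact  (_ , m) l = l ≡ m

Valid : Cell → Set
Valid (h , m) = h ⊑ m

-- The start of the competing walk is arbitrary, so walks of both parities compete, and so do
-- tilings with a block across the cut.
Forces : List Cell → Set
Forces cs = ∀ w → Closed w → Pointwise Compat cs w → Pointwise Exact cs w

bit : Bool → ℕ
bit true  = 1
bit false = 0

weight : Letter → ℕ
weight ⟨ a , s , b ⟩ = bit a + (bit s + bit b)

cost : List Cell → ℕ
cost []             = 0
cost ((h , _) ∷ cs) = weight h + cost cs

cost-++ : ∀ xs ys → cost (xs ++ ys) ≡ cost xs + cost ys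
cost-++ []             ys = refl
cost-++ ((h , _) ∷ xs) ys = trans (cong (weight h +_) (cost-++ xs ys)) (sym (+-assoc (weight h) _ _))

module _ {a b ℓ} {A : Set a} {B : Set b} {R : A → B → Set ℓ} where

  infixr 5 _++ᵖ_
  _++ᵖ_ : ∀ {xs ys v w} → Pointwise R xs v → Pointwise R ys w → Pointwise R (xs ++ ys) (v ++ w)
  []      ++ᵖ q = q
  (x ∷ p) ++ᵖ q = x ∷ (p ++ᵖ q)

  splitᵖ : ∀ xs {ys w} → Pointwise R (xs ++ ys) w →
           ∃₂ λ v₁ v₂ → w ≡ v₁ ++ v₂ × Pointwise R xs v₁ × Pointwise R ys v₂
  splitᵖ []       p       = [] , _ , refl , [] , p
  splitᵖ (x ∷ xs) (r ∷ p) with v₁ , v₂ , refl , a , b ← splitᵖ xs p = _ , v₂ , refl , r ∷ a , b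

  unappendᵖ : ∀ {ℓ′} {R′ : A → B → Set ℓ′} {xs ys v w} → Pointwise R′ xs v →
              Pointwise R (xs ++ ys) (v ++ w) → Pointwise R xs v × Pointwise R ys w
  unappendᵖ []      q       = [] , q
  unappendᵖ (_ ∷ p) (r ∷ q) with a , b ← unappendᵖ p q = r ∷ a , b

exact-marks : ∀ {cs w} → Pointwise Exact cs w → w ≡ marks cs
exact-marks []         = refl
exact-marks (refl ∷ p) = cong (_ ∷_) (exact-marks p)

forces-rotate : ∀ xs {ys} → Forces (xs ++ ys) → Forces (ys ++ xs)
forces-rotate xs {ys} f w (s , walk) compat
  with v₁ , v₂ , refl , p₁ , p₂ ← splitᵖ ys compat
  with t , a , b ← splitʷ v₁ walk
  with x , y ← unappendᵖ p₂ (f (v₂ ++ v₁) (t , b ++ʷ a) (p₂ ++ᵖ p₁))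
  = y ++ᵖ x

-- Even walks as tilings by spokes and blocks

-- A spoke, or a block u_i u_{i+2}, u_{i+1} u_{i+3}, v_i v_{i+1}, v_{i+2} v_{i+3}; the flags tell
-- which of these edges are hit.  In B their order is u_i, u_{i+1}, v_i, v_{i+2}.
data Tile : Set where
  S : Bool → Tile
  B : (x₀ x₁ y₀ y₂ : Bool) → Tile

cells : Tile → List Cell
cells (S h) = (⟨ false , h , false ⟩ , rung) ∷ []
cells (B x₀ x₁ y₀ y₂) = (⟨ x₀ , false , y₀ ⟩ , both) ∷ (⟨ x₁ , false , false ⟩ , rim)
                      ∷ (⟨ false , false , y₂ ⟩ , path) ∷ (none , none) ∷ []

flat : List Tile → List Cell
flat = concatMap cells

flat-++ : ∀ xs ys → flat (xs ++ ys) ≡ flat xs ++ flat ys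
flat-++ = concatMap-++ cells

tile-walk : ∀ t → Walk e₀ (marks (cells t)) e₀
tile-walk (S _)       = e₀-rung ∷ []
tile-walk (B _ _ _ _) = e₀-both ∷ e₁-rim ∷ e₂-path ∷ e₃-none ∷ []

flat-walk : ∀ ts → Walk e₀ (marks (flat ts)) e₀
flat-walk []       = []
flat-walk (t ∷ ts) = subst (λ w → Walk e₀ w e₀) (sym (map-++ proj₂ (cells t) (flat ts)))
                       (tile-walk t ++ʷ flat-walk ts)

imp-true : ∀ b → T (imp b true)
imp-true true  = tt
imp-true false = tt

tile-valid : ∀ t → Pointwise Compat (cells t) (marks (cells t))
tile-valid (S true)  = tt ∷ []
tile-valid (S false) = tt ∷ []
tile-valid (B x₀ x₁ y₀ y₂) = bb x₀ y₀ ∷ b- x₁ ∷ imp-true y₂ ∷ tt ∷ []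
  where
  bb : ∀ x y → T (imp x true ∧ imp y true)
  bb true  y = imp-true y
  bb false y = imp-true y
  b- : ∀ x → T (imp x true ∧ true)
  b- true  = tt
  b- false = tt

flat-valid : ∀ ts → Pointwise Compat (flat ts) (marks (flat ts))
flat-valid []       = []
flat-valid (t ∷ ts) = subst (Pointwise Compat _) (sym (map-++ proj₂ (cells t) (flat ts)))
                        (tile-valid t ++ᵖ flat-valid ts)

below-rung : ∀ h → h ⊑ rung → ∃ λ s → h ≡ ⟨ false , s , false ⟩
below-rung ⟨ false , s     , false ⟩ _ = s , refl
below-rung ⟨ false , true  , true  ⟩ ()
below-rung ⟨ false , false , true  ⟩ ()

below-both : ∀ h → h ⊑ both → ∃₂ λ a b → h ≡ ⟨ a , false , b ⟩
below-both ⟨ a     , false , b ⟩ _ = a , b , refl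
below-both ⟨ true  , true  , b ⟩ ()
below-both ⟨ false , true  , b ⟩ ()

below-rim : ∀ h → h ⊑ rim → ∃ λ a → h ≡ ⟨ a , false , false ⟩
below-rim ⟨ a     , false , false ⟩ _ = a , refl
below-rim ⟨ true  , true  , b     ⟩ ()
below-rim ⟨ false , true  , b     ⟩ ()
below-rim ⟨ true  , false , true  ⟩ ()
below-rim ⟨ false , false , true  ⟩ ()

below-path : ∀ h → h ⊑ path → ∃ λ b → h ≡ ⟨ false , false , b ⟩
below-path ⟨ false , false , b ⟩ _ = b , refl

below-none : ∀ h → h ⊑ none → h ≡ none
below-none none _ = refl

-- At e₀ the letter is `rung` or `both`, and after `both` everything is determined up to the next
-- visit to e₀. Hits lie below the marks, which leaves exactly the flags of a tile.
parse : ∀ cs → Walk e₀ (marks cs) e₀ → All Valid cs → ∃ λ ts → cs ≡ flat ts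
parse [] _ _ = [] , refl
parse ((h , _) ∷ cs) (e₀-rung ∷ w) (ok ∷ vs)
  with ts , refl ← parse cs w vs
  with s , refl ← below-rung h ok = S s ∷ ts , refl
parse ((h₀ , _) ∷ (h₁ , _) ∷ (h₂ , _) ∷ (h₃ , _) ∷ cs) (e₀-both ∷ e₁-rim ∷ e₂-path ∷ e₃-none ∷ w)
      (v₀ ∷ v₁ ∷ v₂ ∷ v₃ ∷ vs)
  with ts , refl ← parse cs w vs
  with x₀ , y₀ , refl ← below-both h₀ v₀
  with x₁ , refl ← below-rim h₁ v₁
  with y₂ , refl ← below-path h₂ v₂
  with refl ← below-none h₃ v₃ = B x₀ x₁ y₀ y₂ ∷ ts , refl

Rigid : List Tile → Set
Rigid ts = Forces (flat ts)

LocallyRigid : List Tile → Set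
LocallyRigid ts = ∀ w → Walk e₀ w e₀ → Pointwise Compat (flat ts) w → Pointwise Exact (flat ts) w

-- A retiling of `y` alone, placed between the unchanged marks of `x` and `z`, is a closed walk that
-- keeps all hits.
rigid-factor : ∀ x y z → Rigid (x ++ y ++ z) → LocallyRigid y
rigid-factor x y z rigid w walk compat
  rewrite flat-++ x (y ++ z) | flat-++ y z
  with _ , p ← unappendᵖ (flat-valid x)
    (rigid (marks (flat x) ++ w ++ marks (flat z))
           (e₀ , flat-walk x ++ʷ walk ++ʷ flat-walk z)
           (flat-valid x ++ᵖ compat ++ᵖ flat-valid z))
  = proj₁ (unappendᵖ compat p)

rigid-rotate : ∀ x y → Rigid (x ++ y) → Rigid (y ++ x)
rigid-rotate x y r rewrite flat-++ x y | flat-++ y x = forces-rotate (flat x) r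

-- Sets of states reachable by competing walks

-- Sets of states, in the order e₀ … e₃, o₀ … o₃.
Row : Set
Row = Vec Bool 8

index : State → Fin 8
index e₀ = 0F
index e₁ = 1F
index e₂ = 2F
index e₃ = 3F
index o₀ = 4F
index o₁ = 5F
index o₂ = 6F
index o₃ = 7F

_∋ᵇ_ : Row → State → Bool
r ∋ᵇ s = lookup r (index s)

infix 4 _∋_
_∋_ : Row → State → Set
r ∋ s = T (r ∋ᵇ s)

∅ : Row
∅ = replicate 8 false

infixr 6 _∪_
_∪_ : Row → Row → Row
_∪_ = zipWith _∨_

only : State → Row
only s = ∅ [ index s ]≔ true

∋-only : ∀ s → only s ∋ s
∋-only s = subst T (sym (lookup∘update (index s) ∅ true)) tt

state : Fin 8 → State
state 0F = e₀
state 1F = e₁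
state 2F = e₂
state 3F = e₃
state 4F = o₀
state 5F = o₁
state 6F = o₂
state 7F = o₃

state-index : ∀ s → state (index s) ≡ s
state-index e₀ = refl
state-index e₁ = refl
state-index e₂ = refl
state-index e₃ = refl
state-index o₀ = refl
state-index o₁ = refl
state-index o₂ = refl
state-index o₃ = refl

only-∋ : ∀ s t → only s ∋ t → t ≡ s
only-∋ s t m with index t Fin.≟ index s
... | yes eq = trans (sym (state-index t)) (trans (cong state eq) (state-index s))
... | no ne  = ⊥-elim (subst T (trans (lookup∘update′ ne ∅ true) (lookup-replicate (index t) false)) m)

∋-∪ˡ : ∀ r r′ s → r ∋ s → r ∪ r′ ∋ s
∋-∪ˡ r r′ s m = subst T (sym (lookup-zipWith _∨_ (index s) r r′)) (Equivalence.from T-∨ (inj₁ m))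

∋-∪ʳ : ∀ r r′ s → r′ ∋ s → r ∪ r′ ∋ s
∋-∪ʳ r r′ s m = subst T (sym (lookup-zipWith _∨_ (index s) r r′))
                  (Equivalence.from (T-∨ {r ∋ᵇ s}) (inj₂ m))

advance : Letter → Row → Row
advance h (a₀ ∷ a₁ ∷ a₂ ∷ a₃ ∷ b₀ ∷ b₁ ∷ b₂ ∷ b₃ ∷ []) =
    (a₀ ∧ h ⊑ᵇ rung ∨ a₃ ∧ h ⊑ᵇ none) ∷ a₀ ∧ h ⊑ᵇ both ∷ a₁ ∧ h ⊑ᵇ rim ∷ a₂ ∧ h ⊑ᵇ path
  ∷ (b₂ ∧ h ⊑ᵇ rung ∨ b₃ ∧ h ⊑ᵇ none) ∷ b₀ ∧ h ⊑ᵇ path ∷ b₁ ∧ h ⊑ᵇ rim ∷ b₂ ∧ h ⊑ᵇ both ∷ []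

reach : Row → List Cell → Row
reach = foldl λ r c → advance (proj₁ c) r

private
  ∧-intro : ∀ {x y} → T x → T y → T (x ∧ y)
  ∧-intro a b = Equivalence.from T-∧ (a , b)

  ∨-introˡ : ∀ {x y} → T x → T (x ∨ y)
  ∨-introˡ a = Equivalence.from T-∨ (inj₁ a)

  ∨-introʳ : ∀ {x y} → T y → T (x ∨ y)
  ∨-introʳ {x} b = Equivalence.from (T-∨ {x}) (inj₂ b)

advance-complete : ∀ {s l t h} r → Step s l t → h ⊑ l → r ∋ s → advance h r ∋ t
advance-complete (_ ∷ _ ∷ _ ∷ _ ∷ _ ∷ _ ∷ _ ∷ _ ∷ []) st c m with st
... | e₀-rung = ∨-introˡ (∧-intro m c)
... | e₀-both = ∧-intro m c
... | e₁-rim  = ∧-intro m c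
... | e₂-path = ∧-intro m c
... | e₃-none = ∨-introʳ (∧-intro m c)
... | o₀-path = ∧-intro m c
... | o₁-rim  = ∧-intro m c
... | o₂-rung = ∨-introˡ (∧-intro m c)
... | o₂-both = ∧-intro m c
... | o₃-none = ∨-introʳ (∧-intro m c)

advance-sound : ∀ {h} r t → advance h r ∋ t → ∃₂ λ s l → Step s l t × h ⊑ l × r ∋ s
advance-sound {h} r@(a₀ ∷ a₁ ∷ a₂ ∷ a₃ ∷ b₀ ∷ b₁ ∷ b₂ ∷ b₃ ∷ []) = go
  where
  via : ∀ {s l t} → Step s l t → T (r ∋ᵇ s ∧ h ⊑ᵇ l) → ∃₂ λ s l → Step s l t × h ⊑ l × r ∋ s
  via st x with m , c ← Equivalence.to T-∧ x = _ , _ , st , c , m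

  go : ∀ t → advance h r ∋ t → ∃₂ λ s l → Step s l t × h ⊑ l × r ∋ s
  go e₀ x with Equivalence.to (T-∨ {a₀ ∧ h ⊑ᵇ rung}) x
  ... | inj₁ y = via e₀-rung y
  ... | inj₂ y = via e₃-none y
  go e₁ x = via e₀-both x
  go e₂ x = via e₁-rim x
  go e₃ x = via e₂-path x
  go o₀ x with Equivalence.to (T-∨ {b₂ ∧ h ⊑ᵇ rung}) x
  ... | inj₁ y = via o₂-rung y
  ... | inj₂ y = via o₃-none y
  go o₁ x = via o₀-path x
  go o₂ x = via o₁-rim x
  go o₃ x = via o₂-both x

reach-complete : ∀ {s t cs w} r → Walk s w t → Pointwise Compat cs w → r ∋ s → reach r cs ∋ t
reach-complete r []       []      m = m
reach-complete r (st ∷ w) (c ∷ p) m = reach-complete _ w p (advance-complete r st c m)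

reach-sound : ∀ r cs t → reach r cs ∋ t → ∃₂ λ s w → r ∋ s × Walk s w t × Pointwise Compat cs w
reach-sound r []       t m = t , [] , m , [] , []
reach-sound r (c ∷ cs) t m
  with s , w , m′ , walk , p ← reach-sound (advance (proj₁ c) r) cs t m
  with s′ , l , st , h , m″ ← advance-sound r s m′
  = s′ , l ∷ w , m″ , st ∷ walk , h ∷ p

follow : State → Letter → State
follow ⟦ _ , q , _ ⟧ ⟨ a , _ , b ⟩ = ⟦ q , a , b ⟧

step-follow : ∀ {s l t} → Step s l t → t ≡ follow s l
step-follow e₀-rung = refl
step-follow e₀-both = refl
step-follow e₁-rim  = refl
step-follow e₂-path = refl
step-follow e₃-none = refl
step-follow o₀-path = refl
step-follow o₁-rim  = refl
step-follow o₂-rung = refl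
step-follow o₂-both = refl
step-follow o₃-none = refl

-- The state entered by a walk that leaves the walk of the marks at the given cell.
branch : State → Cell → Row
-- Only e₀ and o₂ have two outgoing steps.
branch e₀ (h , rung) = if h ⊑ᵇ both then only e₁ else ∅
branch e₀ (h , both) = if h ⊑ᵇ rung then only e₀ else ∅
branch o₂ (h , rung) = if h ⊑ᵇ both then only o₃ else ∅
branch o₂ (h , both) = if h ⊑ᵇ rung then only o₀ else ∅
branch _  _          = ∅

private
  if-T : ∀ {b} {r r′ : Row} {s} → T b → r ∋ s → (if b then r else r′) ∋ s
  if-T {true} _ m = m

branch-complete : ∀ {s t t′ h m l} → Step s m t → Step s l t′ → h ⊑ l → l ≡ m ⊎ branch s (h , m) ∋ t′
branch-complete e₀-rung e₀-rung _ = inj₁ refl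
branch-complete e₀-rung e₀-both c = inj₂ (if-T {s = e₁} c tt)
branch-complete e₀-both e₀-rung c = inj₂ (if-T {s = e₀} c tt)
branch-complete e₀-both e₀-both _ = inj₁ refl
branch-complete e₁-rim  e₁-rim  _ = inj₁ refl
branch-complete e₂-path e₂-path _ = inj₁ refl
branch-complete e₃-none e₃-none _ = inj₁ refl
branch-complete o₀-path o₀-path _ = inj₁ refl
branch-complete o₁-rim  o₁-rim  _ = inj₁ refl
branch-complete o₂-rung o₂-rung _ = inj₁ refl
branch-complete o₂-rung o₂-both c = inj₂ (if-T {s = o₃} c tt)
branch-complete o₂-both o₂-rung c = inj₂ (if-T {s = o₀} c tt)
branch-complete o₂-both o₂-both _ = inj₁ refl
branch-complete o₃-none o₃-none _ = inj₁ refl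

-- The state of the walk of the marks, and the states reached by walks that have left it.
stray₁ : State × Row → Cell → State × Row
stray₁ (s , r) c = follow s (proj₂ c) , advance (proj₁ c) r ∪ branch s c

stray : State × Row → List Cell → State × Row
stray = foldl stray₁

-- A walk that has left the marks stays recorded when it meets them again; otherwise a retiling,
-- which ends in the same state as the marks, would be lost.
stray-kept : ∀ {s t cs w} m r → Walk s w t → Pointwise Compat cs w → r ∋ s → proj₂ (stray (m , r) cs) ∋ t
stray-kept m r [] [] i = i
stray-kept {cs = c ∷ cs} m r (_∷_ {t = t} st w) (h ∷ p) i =
  stray-kept _ _ w p (∋-∪ˡ (advance (proj₁ c) r) _ t (advance-complete r st h i))

stray-complete : ∀ {s t t′ cs w} r → Walk s (marks cs) t′ → Walk s w t → Pointwise Compat cs w →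
                 Pointwise Exact cs w ⊎ proj₂ (stray (s , r) cs) ∋ t
stray-complete r _ [] [] = inj₁ []
stray-complete {s} {cs = (h₀ , m₀) ∷ cs} r (m ∷ ms) (_∷_ {t = t} st w) (h ∷ p) with branch-complete m st h
... | inj₂ i = inj₂ (stray-kept _ _ w p (∋-∪ʳ (advance h₀ r) _ t i))
... | inj₁ refl with refl ← step-follow m | refl ← step-follow st
  with stray-complete (advance h₀ r ∪ branch s (h₀ , m₀)) ms w p
...   | inj₁ e = inj₁ (refl ∷ e)
...   | inj₂ i = inj₂ i

-- Local obstructions to rigidity

-- The block names give the direction and the distance of the slide that keeps the single hit:
-- u_iu_{i+2} also belongs to the block at i-1, v_iv_{i+1} to that at i-2, u_{i+1}u_{i+3} to that at
-- i+1, and v_{i+2}v_{i+3} to that at i+2.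
data Symbol : Set where
  unhit left₁ left₂ right₁ right₂ : Symbol

pattern unhitˢ  = S false
pattern left₁ᴮ  = B true false false false
pattern right₁ᴮ = B false true false false
pattern left₂ᴮ  = B false false true false
pattern right₂ᴮ = B false false false true

tile : Symbol → Tile
tile unhit  = unhitˢ
tile left₁  = left₁ᴮ
tile left₂  = left₂ᴮ
tile right₁ = right₁ᴮ
tile right₂ = right₂ᴮ


-- Four spokes cover the same vertices as a block, and a block followed by spokes the same as
-- spokes followed by a block.
¬rigid-unhit⁴ : ¬ LocallyRigid (unhitˢ ∷ unhitˢ ∷ unhitˢ ∷ unhitˢ ∷ [])
¬rigid-unhit⁴ rigid with rigid _ (e₀-both ∷ e₁-rim ∷ e₂-path ∷ e₃-none ∷ []) (tt ∷ tt ∷ tt ∷ tt ∷ [])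
... | () ∷ _

¬rigid-block : ¬ LocallyRigid (B false false false false ∷ [])
¬rigid-block rigid with rigid _ (e₀-rung ∷ e₀-rung ∷ e₀-rung ∷ e₀-rung ∷ []) (tt ∷ tt ∷ tt ∷ tt ∷ [])
... | () ∷ _

¬rigid-right₁ : ¬ LocallyRigid (right₁ᴮ ∷ unhitˢ ∷ [])
¬rigid-right₁ rigid
  with rigid _ (e₀-rung ∷ e₀-both ∷ e₁-rim ∷ e₂-path ∷ e₃-none ∷ []) (tt ∷ tt ∷ tt ∷ tt ∷ tt ∷ [])
... | () ∷ _

¬rigid-right₂ : ¬ LocallyRigid (right₂ᴮ ∷ unhitˢ ∷ unhitˢ ∷ [])
¬rigid-right₂ rigid
  with rigid _ (e₀-rung ∷ e₀-rung ∷ e₀-both ∷ e₁-rim ∷ e₂-path ∷ e₃-none ∷ [])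
               (tt ∷ tt ∷ tt ∷ tt ∷ tt ∷ tt ∷ [])
... | () ∷ _

¬rigid-left₁ : ¬ LocallyRigid (unhitˢ ∷ left₁ᴮ ∷ [])
¬rigid-left₁ rigid
  with rigid _ (e₀-both ∷ e₁-rim ∷ e₂-path ∷ e₃-none ∷ e₀-rung ∷ []) (tt ∷ tt ∷ tt ∷ tt ∷ tt ∷ [])
... | () ∷ _

¬rigid-left₂ : ¬ LocallyRigid (unhitˢ ∷ unhitˢ ∷ left₂ᴮ ∷ [])
¬rigid-left₂ rigid
  with rigid _ (e₀-both ∷ e₁-rim ∷ e₂-path ∷ e₃-none ∷ e₀-rung ∷ e₀-rung ∷ [])
               (tt ∷ tt ∷ tt ∷ tt ∷ tt ∷ tt ∷ [])
... | () ∷ _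

-- Enough hits for a loss of 2 whatever was read before, as ψ ≤ 3.
Heavy : Tile → Set
Heavy t = 5 + length (cells t) ≤ 6 * cost (cells t)

classify : ∀ t → LocallyRigid (t ∷ []) → (∃ λ x → t ≡ tile x) ⊎ Heavy t
classify (S false) _ = inj₁ (unhit , refl)
classify (S true)  _ = inj₂ ≤-refl
classify (B false false false false) rigid = ⊥-elim (¬rigid-block rigid)
classify left₁ᴮ  _ = inj₁ (left₁ , refl)
classify left₂ᴮ  _ = inj₁ (left₂ , refl)
classify right₁ᴮ _ = inj₁ (right₁ , refl)
classify right₂ᴮ _ = inj₁ (right₂ , refl)
classify (B true  true  false false) _ = inj₂ (≤ᵇ⇒≤ _ _ tt)
classify (B true  false true  false) _ = inj₂ (≤ᵇ⇒≤ _ _ tt)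
classify (B true  false false true ) _ = inj₂ (≤ᵇ⇒≤ _ _ tt)
classify (B false true  true  false) _ = inj₂ (≤ᵇ⇒≤ _ _ tt)
classify (B false true  false true ) _ = inj₂ (≤ᵇ⇒≤ _ _ tt)
classify (B false false true  true ) _ = inj₂ (≤ᵇ⇒≤ _ _ tt)
classify (B true  true  true  false) _ = inj₂ (≤ᵇ⇒≤ _ _ tt)
classify (B true  true  false true ) _ = inj₂ (≤ᵇ⇒≤ _ _ tt)
classify (B true  false true  true ) _ = inj₂ (≤ᵇ⇒≤ _ _ tt)
classify (B false true  true  true ) _ = inj₂ (≤ᵇ⇒≤ _ _ tt)
classify (B true  true  true  true ) _ = inj₂ (≤ᵇ⇒≤ _ _ tt)

-- The scan and its potential

-- What the tiles just read allow next: freeⱼ stands for j unhit spokes after a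
-- tile that cannot slide to the right, past₁ and past₂ for a block that can slide
-- by one or two places, past₂S for one unhit spoke after the latter.
Q : Set
Q = Fin 7

pattern free₀  = 0F
pattern free₁  = 1F
pattern free₂  = 2F
pattern free₃  = 3F
pattern past₁  = 4F
pattern past₂  = 5F
pattern past₂S = 6F

-- Chosen so that 6 · (hits) + ψ (after) = length + ψ (before) + loss with every loss
-- nonnegative, as `balance` says.
ψ : Q → ℕ
ψ free₀  = 0
ψ free₁  = 1
ψ free₂  = 2
ψ free₃  = 3
ψ past₁  = 1
ψ past₂  = 1
ψ past₂S = 2

-- The losses are dictated by `balance`: a block has four positions and one hit, so the loss is 3 -
-- ψ q for a block that slides right, which ends at potential 1, and 2 - ψ q for one that slides
-- left, which ends at 0. For the latter, `nothing` marks a slide that the preceding spokes permit.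
loss-right : Q → ℕ
loss-right free₀  = 3
loss-right free₁  = 2
loss-right free₂  = 1
loss-right free₃  = 0
loss-right past₁  = 2
loss-right past₂  = 2
loss-right past₂S = 1

loss-left₁ loss-left₂ : Q → Maybe ℕ
loss-left₁ free₀ = just 2
loss-left₁ past₁ = just 1
loss-left₁ past₂ = just 1
loss-left₁ _     = nothing
loss-left₂ free₁  = just 1
loss-left₂ past₂S = just 0
loss-left₂ q      = loss-left₁ q

step-spoke : Q → Maybe (Q × ℕ)
step-spoke free₀ = just (free₁ , 0)
step-spoke free₁ = just (free₂ , 0)
step-spoke free₂ = just (free₃ , 0)
step-spoke past₂ = just (past₂S , 0)
step-spoke _     = nothing

step : Q → Symbol → Maybe (Q × ℕ)
step q unhit  = step-spoke q
step q right₁ = just (past₁ , loss-right q)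
step q right₂ = just (past₂ , loss-right q)
step q left₁  = Maybe.map (free₀ ,_) (loss-left₁ q)
step q left₂  = Maybe.map (free₀ ,_) (loss-left₂ q)

symbols : List Symbol
symbols = unhit ∷ left₁ ∷ left₂ ∷ right₁ ∷ right₂ ∷ []

∈-symbols : ∀ x → x ∈ˡ symbols
∈-symbols unhit  = here refl
∈-symbols left₁  = there (here refl)
∈-symbols left₂  = there (there (here refl))
∈-symbols right₁ = there (there (there (here refl)))
∈-symbols right₂ = there (there (there (there (here refl))))

all-elim : ∀ {A : Set} (p : A → Bool) xs → T (all p xs) → ∀ {x} → x ∈ˡ xs → T (p x)
all-elim p xs t = All.lookup (All.all⁺ p xs t)

balance : ∀ q x {q′ d} → step q x ≡ just (q′ , d) →
          length (cells (tile x)) + (ψ q + d) ≡ 6 * cost (cells (tile x)) + ψ q′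
balance q x eq = ≡ᵇ⇒≡ _ _ (subst (λ m → T (ok x q m)) eq
    (all-elim (λ x → ok x q (step q x)) symbols
      (all-elim (λ q → all (λ x → ok x q (step q x)) symbols) (allFin 7) tt (∈-allFin q)) (∈-symbols x)))
  where
  ok : Symbol → Q → Maybe (Q × ℕ) → Bool
  ok x q = maybe (λ (q′ , d) → length (cells (tile x)) + (ψ q + d) ≡ᵇ 6 * cost (cells (tile x)) + ψ q′) true

-- A heavy tile is charged a loss of 2 and resets the scan to `free₀`, a state that claims nothing
-- about the tiles before it. A path of loss at most 1 is therefore spelled by symbols alone.
data Path : Q → List Tile → Q → ℕ → Set where
  []    : ∀ {q} → Path q [] q 0
  light : ∀ {q x q′ l ts r d} → step q x ≡ just (q′ , l) → Path q′ ts r d → Path q (tile x ∷ ts) r (l + d)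
  heavy : ∀ {q t ts r d} → Heavy t → Path free₀ ts r d → Path q (t ∷ ts) r (2 + d)

ψ≤3 : ∀ q → ψ q ≤ 3
ψ≤3 q = ≤ᵇ⇒≤ _ _ (all-elim (λ q → ψ q ≤ᵇ 3) (allFin 7) tt (∈-allFin q))

heavy-balance : ∀ q t → Heavy t → length (cells t) + (ψ q + 2) ≤ 6 * cost (cells t) + 0
heavy-balance q t h = begin
  length (cells t) + (ψ q + 2) ≤⟨ +-monoʳ-≤ (length (cells t)) (+-monoˡ-≤ 2 (ψ≤3 q)) ⟩
  length (cells t) + 5         ≡⟨ +-comm (length (cells t)) 5 ⟩
  5 + length (cells t)         ≤⟨ h ⟩
  6 * cost (cells t)           ≡⟨ +-identityʳ _ ⟨
  6 * cost (cells t) + 0       ∎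
  where open ≤-Reasoning

combine-balance : ∀ n₁ n₂ c₁ c₂ q q′ r l d → n₁ + (q + l) ≤ 6 * c₁ + q′ → n₂ + (q′ + d) ≤ 6 * c₂ + r →
                  (n₁ + n₂) + (q + (l + d)) ≤ 6 * (c₁ + c₂) + r
combine-balance n₁ n₂ c₁ c₂ q q′ r l d a b = begin
  (n₁ + n₂) + (q + (l + d))   ≡⟨ solve 5 (λ n₁ n₂ q l d → (n₁ :+ n₂) :+ (q :+ (l :+ d)) := (n₁ :+ (q :+ l)) :+ (n₂ :+ d))
                                   refl n₁ n₂ q l d ⟩
  (n₁ + (q + l)) + (n₂ + d)   ≤⟨ +-monoˡ-≤ (n₂ + d) a ⟩
  (6 * c₁ + q′) + (n₂ + d)    ≡⟨ solve 4 (λ c n q d → (c :+ q) :+ (n :+ d) := c :+ (n :+ (q :+ d)))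
                                   refl (6 * c₁) n₂ q′ d ⟩
  6 * c₁ + (n₂ + (q′ + d))    ≤⟨ +-monoʳ-≤ (6 * c₁) b ⟩
  6 * c₁ + (6 * c₂ + r)       ≡⟨ +-assoc (6 * c₁) (6 * c₂) r ⟨
  (6 * c₁ + 6 * c₂) + r       ≡⟨ cong (_+ r) (*-distribˡ-+ 6 c₁ c₂) ⟨
  6 * (c₁ + c₂) + r           ∎
  where
  open ≤-Reasoning
  open +-*-Solver

path-balance : ∀ {q ts r d} → Path q ts r d → length (flat ts) + (ψ q + d) ≤ 6 * cost (flat ts) + ψ r
path-balance {q} [] = ≤-reflexive (+-identityʳ (ψ q))
path-balance {q} {r = r} (light {x = x} {q′} {l} {ts} {d = d} eq p)
  rewrite length-++ (cells (tile x)) {flat ts} | cost-++ (cells (tile x)) (flat ts)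
  = combine-balance (length (cells (tile x))) _ (cost (cells (tile x))) (cost (flat ts)) (ψ q) (ψ q′) (ψ r) l d
      (≤-reflexive (balance q x eq)) (path-balance p)
path-balance {q} {r = r} (heavy {t = t} {ts} {d = d} h p)
  rewrite length-++ (cells t) {flat ts} | cost-++ (cells t) (flat ts)
  = combine-balance (length (cells t)) _ (cost (cells t)) (cost (flat ts)) (ψ q) 0 (ψ r) 2 d
      (heavy-balance q t h) (path-balance p)

-- Scanning a circular word for forbidden factors

-- The last tiles read in state q, from the last block or hit spoke on, and the
-- unhit spokes among them.
recent spokes : Q → List Tile
recent past₁  = right₁ᴮ ∷ []
recent past₂  = right₂ᴮ ∷ []
recent past₂S = right₂ᴮ ∷ unhitˢ ∷ []
recent q      = spokes q
spokes free₁  = unhitˢ ∷ []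
spokes free₂  = unhitˢ ∷ unhitˢ ∷ []
spokes free₃  = unhitˢ ∷ unhitˢ ∷ unhitˢ ∷ []
spokes past₂S = unhitˢ ∷ []
spokes _      = []

EndsWith : List Tile → List Tile → Set
EndsWith x y = ∃ λ z → x ≡ z ++ y

Clean : List Tile → Set
Clean ts = ∀ x y z → ts ≡ x ++ y ++ z → LocallyRigid y

endsWith-∷ʳ : ∀ {x y} t → EndsWith x y → EndsWith (x ++ t ∷ []) (y ++ t ∷ [])
endsWith-∷ʳ t (z , refl) = z , ++-assoc z _ _

endsWith-trans : ∀ {x y z} → EndsWith x y → EndsWith y z → EndsWith x z
endsWith-trans (a , refl) (b , refl) = a ++ b , sym (++-assoc a b _)

endsWith-refl : ∀ {x} → EndsWith x x
endsWith-refl = [] , refl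

endsWith-[] : ∀ {x} → EndsWith x []
endsWith-[] {x} = x , sym (++-identityʳ x)

data Block : Symbol → Set where
  left₁  : Block left₁
  left₂  : Block left₂
  right₁ : Block right₁
  right₂ : Block right₂

landing : Symbol → Q
landing right₁ = past₁
landing right₂ = past₂
landing _      = free₀

step-landing : ∀ q {x q′ l} → Block x → step q x ≡ just (q′ , l) → q′ ≡ landing x
step-landing q left₁ eq with loss-left₁ q | eq
... | just _ | refl = refl
step-landing q left₂ eq with loss-left₂ q | eq
... | just _ | refl = refl
step-landing q right₁ refl = refl
step-landing q right₂ refl = refl

spokes-landing : ∀ x → spokes (landing x) ≡ []
spokes-landing unhit  = refl
spokes-landing left₁  = refl
spokes-landing left₂  = refl
spokes-landing right₁ = refl
spokes-landing right₂ = refl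

recent-landing : ∀ {x} → Block x → EndsWith (tile x ∷ []) (recent (landing x))
recent-landing left₁  = endsWith-[]
recent-landing left₂  = endsWith-[]
recent-landing right₁ = endsWith-refl
recent-landing right₂ = endsWith-refl

step-unhit : ∀ q {q′ l} → step q unhit ≡ just (q′ , l) →
             recent q ++ unhitˢ ∷ [] ≡ recent q′ × spokes q ++ unhitˢ ∷ [] ≡ spokes q′
step-unhit free₀ refl = refl , refl
step-unhit free₁ refl = refl , refl
step-unhit free₂ refl = refl , refl
step-unhit past₂ refl = refl , refl

blocked-unhit : ∀ q → step q unhit ≡ nothing →
                ∃ λ bad → EndsWith (recent q ++ unhitˢ ∷ []) bad × ¬ LocallyRigid bad
blocked-unhit free₃  _ = _ , endsWith-refl , ¬rigid-unhit⁴
blocked-unhit past₁  _ = _ , endsWith-refl , ¬rigid-right₁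
blocked-unhit past₂S _ = _ , endsWith-refl , ¬rigid-right₂

blocked-block : ∀ q {x} → Block x → step q x ≡ nothing →
                ∃ λ bad → EndsWith (spokes q ++ tile x ∷ []) bad × ¬ LocallyRigid bad
blocked-block free₁  left₁ _ = _ , endsWith-refl , ¬rigid-left₁
blocked-block free₂  left₁ _ = _ , (_ ∷ [] , refl) , ¬rigid-left₁
blocked-block free₃  left₁ _ = _ , (_ ∷ _ ∷ [] , refl) , ¬rigid-left₁
blocked-block past₂S left₁ _ = _ , endsWith-refl , ¬rigid-left₁
blocked-block free₂  left₂ _ = _ , endsWith-refl , ¬rigid-left₂
blocked-block free₃  left₂ _ = _ , (_ ∷ [] , refl) , ¬rigid-left₂
blocked-block past₁  left₂ ()
blocked-block past₂  left₂ ()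
blocked-block past₂S left₂ ()

block? : ∀ x → x ≡ unhit ⊎ Block x
block? unhit  = inj₁ refl
block? left₁  = inj₂ left₁
block? left₂  = inj₂ left₂
block? right₁ = inj₂ right₁
block? right₂ = inj₂ right₂

clean-end : ∀ {ts x y} z → Clean ts → ts ≡ x ++ z → EndsWith x y → LocallyRigid y
clean-end z clean refl (w , refl) = clean w _ z (++-assoc w _ z)

-- A circular word of tiles, cut before and after the tile `anchor`.
module Scan (anchor : Tile) (tail : List Tile)
            (front : Clean (anchor ∷ tail)) (back : Clean (tail ++ anchor ∷ [])) where

  -- A forbidden factor that ends in a spoke may begin with the anchor, and one that ends in a block
  -- may end with the anchor. Neither does both, so each lies in one of the two linear cuts:
  -- `recent` may reach back into the anchor, `spokes` stays inside the tail.
  Tracks : Q → List Tile → Set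
  Tracks q pre = EndsWith (anchor ∷ pre) (recent q) × EndsWith pre (spokes q)

  track-block : ∀ {q x q′ l pre} → Block x → step q x ≡ just (q′ , l) → Tracks q′ (pre ++ tile x ∷ [])
  track-block {q} {x} {pre = pre} b eq with refl ← step-landing q b eq
    = endsWith-trans (anchor ∷ pre , refl) (recent-landing b)
    , subst (EndsWith _) (sym (spokes-landing x)) endsWith-[]

  track-heavy : ∀ {pre} → Tracks free₀ pre
  track-heavy = endsWith-[] , endsWith-[]

  track-unhit : ∀ {q q′ l pre} → step q unhit ≡ just (q′ , l) → Tracks q pre → Tracks q′ (pre ++ unhitˢ ∷ [])
  track-unhit {q} eq (a , b) with e , e′ ← step-unhit q eq
    = subst (EndsWith _) e (endsWith-∷ʳ unhitˢ a) , subst (EndsWith _) e′ (endsWith-∷ʳ unhitˢ b)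

  follow-tail : ∀ pre ts q → pre ++ ts ≡ tail → Tracks q pre → ∃₂ λ r d → Path q ts r d × Tracks r tail
  follow-tail pre [] q eq tr rewrite ++-identityʳ pre | eq = q , 0 , [] , tr
  follow-tail pre (t ∷ ts) q eq tr@(a , b) = go (classify t (clean-end ts front eq₁ ((anchor ∷ pre) , refl)))
    where
    eq′ : (pre ++ t ∷ []) ++ ts ≡ tail
    eq′ = trans (++-assoc pre (t ∷ []) ts) eq

    eq₁ : anchor ∷ tail ≡ (anchor ∷ pre ++ t ∷ []) ++ ts
    eq₁ = cong (anchor ∷_) (sym eq′)

    eq₂ : tail ++ anchor ∷ [] ≡ (pre ++ t ∷ []) ++ (ts ++ anchor ∷ [])
    eq₂ = trans (cong (_++ anchor ∷ []) (sym eq′)) (++-assoc (pre ++ t ∷ []) ts (anchor ∷ []))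

    go : (∃ λ x → t ≡ tile x) ⊎ Heavy t → ∃₂ λ r d → Path q (t ∷ ts) r d × Tracks r tail
    go (inj₂ h) with r , d , p , tr′ ← follow-tail (pre ++ t ∷ []) ts free₀ eq′ track-heavy
      = r , 2 + d , heavy h p , tr′
    go (inj₁ (x , refl)) with step q x in s
    ... | just (q′ , l) = extend (block? x)
      where
      next : Tracks q′ (pre ++ t ∷ []) → ∃₂ λ r d → Path q (t ∷ ts) r d × Tracks r tail
      next tr′ with r , d , p , tr″ ← follow-tail (pre ++ t ∷ []) ts q′ eq′ tr′
        = r , l + d , light s p , tr″

      extend : x ≡ unhit ⊎ Block x → ∃₂ λ r d → Path q (t ∷ ts) r d × Tracks r tail
      extend (inj₁ refl) = next (track-unhit s tr)
      extend (inj₂ b)    = next (track-block {q} b s)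
    ... | nothing with block? x
    ...   | inj₁ refl with bad , e , ¬r ← blocked-unhit q s
          = ⊥-elim (¬r (clean-end ts front eq₁ (endsWith-trans (endsWith-∷ʳ t a) e)))
    ...   | inj₂ blk with bad , e , ¬r ← blocked-block q blk s
          = ⊥-elim (¬r (clean-end _ back eq₂ (endsWith-trans (endsWith-∷ʳ t b) e)))

  return : ∀ {q x} → Block x → anchor ≡ tile x → Tracks q tail → ∃ λ l → step q x ≡ just (landing x , l)
  return {q} {x} b refl (_ , tr) with step q x in s
  ... | just (q′ , l) with refl ← step-landing q b s = l , refl
  ... | nothing with bad , e , ¬r ← blocked-block q b s
      = ⊥-elim (¬r (clean-end [] back (sym (++-identityʳ _)) (endsWith-trans (endsWith-∷ʳ anchor tr) e)))

-- Finite exploration of the histories of loss at most 1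

-- The scan state, the loss so far, whether some hit has been read, and the odd states
-- reached from o₀, o₁, o₂ and o₃.
Config : Set
Config = Q × ℕ × Bool × Vec Row 4

_≟ᶜ_ : DecidableEquality Config
_≟ᶜ_ = ×-≡-dec Fin._≟_ (×-≡-dec ℕ._≟_ (×-≡-dec Bool._≟_ (Vec-≡-dec (Vec-≡-dec Bool._≟_))))

open import Data.List.Membership.DecPropositional _≟ᶜ_ using (_∈?_)

reaches : ∀ {n} → Vec Row n → List Cell → Vec Row n
reaches rows cs = Vec.map (λ r → reach r cs) rows

isBlock : Symbol → Bool
isBlock unhit = false
isBlock _     = true

grow′ : Config → Symbol → Maybe (Q × ℕ) → Maybe Config
grow′ (q , d , m , rows) x nothing         = nothing
grow′ (q , d , m , rows) x (just (q′ , l)) =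
  if d + l ≤ᵇ 1 then just (q′ , d + l , m ∨ isBlock x , reaches rows (cells (tile x))) else nothing

grow : Config → Symbol → Maybe Config
grow c x = grow′ c x (step (proj₁ c) x)

-- The first argument is fuel; running out of it would make `certified` fail.
closure : ℕ → List Config → List Config → List Config
closure zero    todo       seen = seen
closure (suc k) []         seen = seen
closure (suc k) (c ∷ todo) seen =
  if ⌊ c ∈? seen ⌋ then closure k todo seen
  else closure k (mapMaybe (grow c) symbols ++ todo) (c ∷ seen)

-- The circle is cut just after the anchor, whose own loss and cells are accounted for when the scan
-- returns to it.
start : Symbol → Config
start x = landing x , 0 , false , Vec.map only (o₀ ∷ o₁ ∷ o₂ ∷ o₃ ∷ [])

configs : Symbol → List Config
configs x = closure 600 (start x ∷ []) []

diag : Vec Row 4 → Bool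
diag (r₀ ∷ r₁ ∷ r₂ ∷ r₃ ∷ []) = (r₀ ∋ᵇ o₀) ∨ (r₁ ∋ᵇ o₁) ∨ (r₂ ∋ᵇ o₂) ∨ (r₃ ∋ᵇ o₃)

within : List Config → Maybe Config → Bool
within cs = maybe (λ c → ⌊ c ∈? cs ⌋) true

-- A tail without hits leaves a single hit in all, hence a length of at most 6, and the odd walk can
-- then be missing: `right₂ᴮ ∷ unhitˢ ∷ []` has length 5, which is no sum of 3s and 4s. The flag
-- exempts these words here, and `hit-tail` excludes them by n ≥ 11.
recurrent : Bool → Maybe Config → Bool
recurrent hit = maybe (λ (_ , _ , _ , rows) → not hit ∨ diag rows) true

stable : List Config → Config → Bool
stable cs c = all (λ y → within cs (grow c y)) symbols

returns : Symbol → Config → Bool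
returns x c = recurrent (proj₁ (proj₂ (proj₂ c))) (grow c x)

-- Membership of the start and closedness under `grow` are checked on the finished list, so the
-- soundness of the certificate does not depend on how `closure` found it.
accepts : Symbol → List Config → Bool
accepts x cs = ⌊ start x ∈? cs ⌋ ∧
  all (λ c → stable cs c ∧ returns x c) cs

-- A data type rather than a synonym, so that the type checker evaluates the certificates only once.
data Certified (x : Symbol) : Set where
  certify : T (accepts x (configs x)) → Certified x

certified : ∀ {x} → Block x → Certified x
certified left₁  = certify tt
certified left₂  = certify tt
certified right₁ = certify tt
certified right₂ = certify tt

reaches-++ : ∀ {n} (rows : Vec Row n) xs ys → reaches (reaches rows xs) ys ≡ reaches rows (xs ++ ys)
reaches-++ rows xs ys = trans (sym (map-∘ _ _ rows))
  (map-cong (λ r → sym (foldl-++ (λ r c → advance (proj₁ c) r) r xs ys)) rows)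

Odd : State → Set
Odd s = T (parity s)

reach-only : ∀ {s cs} → reach (only s) cs ∋ s → ∃ λ w → Walk s w s × Pointwise Compat cs w
reach-only {s} {cs} m with s′ , w , i , walk , p ← reach-sound (only s) cs s m
  with refl ← only-∋ s s′ i = w , walk , p

odd-starts : Vec Row 4
odd-starts = Vec.map only (o₀ ∷ o₁ ∷ o₂ ∷ o₃ ∷ [])

diag-walk : ∀ cs → T (diag (reaches odd-starts cs)) →
            ∃₂ λ s w → Odd s × Walk s w s × Pointwise Compat cs w
diag-walk cs t with Equivalence.to (T-∨ {reach (only o₀) cs ∋ᵇ o₀}) t
... | inj₁ m = o₀ , _ , tt , proj₂ (reach-only m)
... | inj₂ t with Equivalence.to (T-∨ {reach (only o₁) cs ∋ᵇ o₁}) t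
...   | inj₁ m = o₁ , _ , tt , proj₂ (reach-only m)
...   | inj₂ t with Equivalence.to (T-∨ {reach (only o₂) cs ∋ᵇ o₂}) t
...     | inj₁ m = o₂ , _ , tt , proj₂ (reach-only m)
...     | inj₂ m = o₃ , _ , tt , proj₂ (reach-only m)

-- In the odd half `both` is followed by `none`, never by `rim`, so no odd walk spells a block. An
-- odd competitor thus differs from the marks of any word that contains a block.
¬odd-block : ∀ {x₀ x₁ y₀ y₂ s} ts → Odd s → ¬ Walk s (marks (flat (ts ++ B x₀ x₁ y₀ y₂ ∷ []))) s
¬odd-block {x₀} {x₁} {y₀} {y₂} ts odd w
  rewrite flat-++ ts (B x₀ x₁ y₀ y₂ ∷ []) | map-++ proj₂ (flat ts) (flat (B x₀ x₁ y₀ y₂ ∷ []))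
  with _ , _ , end ← splitʷ (marks (flat ts)) w = go odd end
  where
  go : ∀ {s t} → Odd s → ¬ Walk t (both ∷ rim ∷ path ∷ none ∷ []) s
  go () (e₀-both ∷ e₁-rim ∷ e₂-path ∷ e₃-none ∷ [])

module Explore (x : Symbol) (cs : List Config) (ok : T (accepts x cs)) where

  private
    start∈ : start x ∈ˡ cs
    start∈ = toWitness {a? = start x ∈? cs} (proj₁ (Equivalence.to T-∧ ok))

    each : ∀ {c} → c ∈ˡ cs → T (stable cs c) × T (returns x c)
    each i = Equivalence.to T-∧
      (all-elim (λ c → stable cs c ∧ returns x c) cs (proj₂ (Equivalence.to T-∧ ok)) i)

    grow-∈ : ∀ {c c′} y → c ∈ˡ cs → grow c y ≡ just c′ → c′ ∈ˡ cs
    grow-∈ {c} {c′} y i eq = toWitness {a? = c′ ∈? cs} (subst (T ∘ within cs) eq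
                               (all-elim (λ y → within cs (grow c y)) symbols (proj₁ (each i)) (∈-symbols y)))

    grow-just : ∀ {q q′ d l m rows} y → step q y ≡ just (q′ , l) → d + l ≤ 1 →
                grow (q , d , m , rows) y ≡ just (q′ , d + l , m ∨ isBlock y , reaches rows (cells (tile y)))
    grow-just {d = d} {l} y eq le rewrite eq with d + l ≤ᵇ 1 | ≤⇒≤ᵇ le
    ... | true | _ = refl

    ∨-false : ∀ m y → m ∨ isBlock y ≡ false → m ≡ false × y ≡ unhit
    ∨-false false unhit _ = refl , refl

  follow-path : ∀ {q d m rows ts r d′} → (q , d , m , rows) ∈ˡ cs → Path q ts r d′ → d + d′ ≤ 1 →
                ∃ λ m′ → (r , d + d′ , m′ , reaches rows (flat ts)) ∈ˡ cs ×
                         (m′ ≡ false → m ≡ false × cost (flat ts) ≡ 0)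
  follow-path {q} {d} {m} {rows} i [] le
    = m , subst₂ (λ d rows → (q , d , m , rows) ∈ˡ cs) (sym (+-identityʳ d)) (sym (map-id rows)) i
    , λ e → e , refl
  follow-path {d = d} {m} {rows} i (light {x = y} {q′} {l} {ts} {r} {d′} eq p) le
    with m′ , i′ , f ← follow-path (grow-∈ y i (grow-just {d = d} {l} {m} {rows} y eq
                         (≤-trans (+-monoʳ-≤ d (m≤m+n l d′)) le)))
                         p (subst (_≤ 1) (sym (+-assoc d l d′)) le)
    = m′
    , subst₂ (λ d rows → (r , d , m′ , rows) ∈ˡ cs) (+-assoc d l d′) (reaches-++ rows (cells (tile y)) (flat ts)) i′
    , λ e → unread (f e)
    where
    unread : m ∨ isBlock y ≡ false × cost (flat ts) ≡ 0 → m ≡ false × cost (flat (tile y ∷ ts)) ≡ 0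
    unread (e , z) with refl , refl ← ∨-false m y e = refl , z
  follow-path {d = d} i (heavy {d = d′} _ _) le
    with s≤s () ← ≤-trans (≤-trans (m≤m+n 2 d′) (m≤n+m (2 + d′) d)) le

  odd-walk : ∀ {q l d tail} → Path (landing x) tail q d → step q x ≡ just (landing x , l) → d + l ≤ 1 →
             cost (flat tail) ≢ 0 →
             ∃₂ λ s w → Odd s × Walk s w s × Pointwise Compat (flat (tail ++ tile x ∷ [])) w
  odd-walk {q} {l} {d} {tail} p eq le nz
    with follow-path start∈ p (≤-trans (m≤m+n d l) le)
  ... | false , _ , f = ⊥-elim (nz (proj₂ (f refl)))
  ... | true , i , _ with s , w , odd , walk , c ← diag-walk (flat tail ++ cells (tile x)) (subst (T ∘ diag)
          (reaches-++ odd-starts (flat tail) (cells (tile x)))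
          (subst (T ∘ recurrent true) (grow-just {d = d} {l} {true} {reaches odd-starts (flat tail)} x eq le)
            (proj₂ (each i))))
    = s , w , odd , walk
    , subst (λ v → Pointwise Compat v w)
        (sym (trans (flat-++ tail (tile x ∷ [])) (cong (flat tail ++_) (++-identityʳ (cells (tile x)))))) c

-- The lower bound around the circle

rigid-clean : ∀ {ts} → Rigid ts → Clean ts
rigid-clean r x y z refl = rigid-factor x y z r

size : List Tile → ℕ
size ts = length (flat ts)

block-tile : ∀ {x} → Block x → cost (cells (tile x)) ≡ 1 × ∃₂ λ x₀ x₁ → ∃₂ λ y₀ y₂ → tile x ≡ B x₀ x₁ y₀ y₂
block-tile left₁  = refl , _ , _ , _ , _ , refl
block-tile left₂  = refl , _ , _ , _ , _ , refl
block-tile right₁ = refl , _ , _ , _ , _ , refl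
block-tile right₂ = refl , _ , _ , _ , _ , refl

bound-from : ∀ t ts → t ≢ unhitˢ → Rigid (t ∷ ts) → 11 ≤ size (t ∷ ts) →
             2 + size (t ∷ ts) ≤ 6 * cost (flat (t ∷ ts))
bound-from t ts t≢ rigid big = go (classify t (rigid-factor [] (t ∷ []) ts rigid))
  where
  rigid′ : Rigid (ts ++ t ∷ [])
  rigid′ = rigid-rotate (t ∷ []) ts rigid

  open Scan t ts (rigid-clean rigid) (rigid-clean rigid′)

  -- The scan ends in the potential with which it began, so `ψ q` cancels and only the losses
  -- remain.
  total : ∀ {q r d l} → Path q ts r d → length (cells t) + (ψ r + l) ≤ 6 * cost (cells t) + ψ q →
          size (t ∷ ts) + (d + l) ≤ 6 * cost (flat (t ∷ ts))
  total {q} {r} {d} {l} p back = subst₂ _≤_ lhs rhs (+-cancelʳ-≤ (ψ q) _ _ (≤-trans (≤-reflexive shift)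
      (combine-balance (size ts) (length (cells t)) (cost (flat ts)) (cost (cells t)) (ψ q) (ψ r) (ψ q) d l
        (path-balance p) back)))
    where
    lhs : (size ts + length (cells t)) + (d + l) ≡ size (t ∷ ts) + (d + l)
    lhs = cong (_+ (d + l)) (trans (+-comm (size ts) _) (sym (length-++ (cells t))))
    rhs : 6 * (cost (flat ts) + cost (cells t)) ≡ 6 * cost (flat (t ∷ ts))
    rhs = cong (6 *_) (trans (+-comm (cost (flat ts)) _) (sym (cost-++ (cells t) (flat ts))))
    shift : ((size ts + length (cells t)) + (d + l)) + ψ q ≡ (size ts + length (cells t)) + (ψ q + (d + l))
    shift = trans (+-assoc (size ts + length (cells t)) (d + l) (ψ q))
      (cong ((size ts + length (cells t)) +_) (+-comm (d + l) (ψ q)))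

  enough : ∀ {e} → size (t ∷ ts) + e ≤ 6 * cost (flat (t ∷ ts)) → 2 ≤ e →
           2 + size (t ∷ ts) ≤ 6 * cost (flat (t ∷ ts))
  enough le 2≤e = ≤-trans (≤-reflexive (+-comm 2 (size (t ∷ ts)))) (≤-trans (+-monoʳ-≤ (size (t ∷ ts)) 2≤e) le)

  hit-tail : ∀ {x e} → Block x → t ≡ tile x →
             size (t ∷ ts) + e ≤ 6 * cost (flat (t ∷ ts)) → cost (flat ts) ≢ 0
  hit-tail {e = e} b refl sum z = ≤⇒≯ (≤-trans (≤-trans big (m≤m+n (size (t ∷ ts)) e)) sum)
    (subst (λ c → 6 * c < 11) (sym (trans (cost-++ (cells t) (flat ts)) (cong₂ _+_ (proj₁ (block-tile b)) z)))
      (≤ᵇ⇒≤ 7 11 tt))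

  go : (∃ λ x → t ≡ tile x) ⊎ Heavy t → 2 + size (t ∷ ts) ≤ 6 * cost (flat (t ∷ ts))
  go (inj₂ h) with q , d , p , _ ← follow-tail [] ts free₀ refl track-heavy
    = enough (total {l = 2} p (heavy-balance q t h)) (m≤n+m 2 d)
  go (inj₁ (x , refl)) with block? x
  ... | inj₁ refl = ⊥-elim (t≢ refl)
  ... | inj₂ b
    with q , d , p , tr ← follow-tail [] ts (landing x) refl
           (recent-landing b , subst (EndsWith []) (sym (spokes-landing x)) endsWith-refl)
    with l , eq ← return {q} b refl tr
    with sum ← total {l = l} p (≤-reflexive (balance q x eq))
    with 2 ≤? d + l
  ...   | yes 2≤ = enough sum 2≤
  ...   | no ≰2
    with certify ok ← certified b
    with s , w , odd , walk , c ← Explore.odd-walk x (configs x) ok p eq (≤-pred (≰⇒> ≰2))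
                                         (hit-tail b refl sum)
    with one , _ , _ , _ , _ , blk ← block-tile b
    = ⊥-elim (¬odd-block ts odd (subst (λ t → Walk s (marks (flat (ts ++ t ∷ []))) s) blk
               (subst (λ w → Walk s w s) (exact-marks (rigid′ w (s , walk) c)) walk)))

Bounded : List Cell → Set
Bounded cs = 11 ≤ length cs → 2 + length cs ≤ 6 * cost cs

bounded-rotate : ∀ xs {ys} → Bounded (ys ++ xs) → Bounded (xs ++ ys)
bounded-rotate xs {ys} b big = subst₂ (λ n c → 2 + n ≤ 6 * c) same-length same-cost
                                 (b (subst (11 ≤_) (sym same-length) big))
  where
  same-length : length (ys ++ xs) ≡ length (xs ++ ys)
  same-length = trans (length-++ ys) (trans (+-comm (length ys) (length xs)) (sym (length-++ xs)))
  same-cost : cost (ys ++ xs) ≡ cost (xs ++ ys)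
  same-cost = trans (cost-++ ys xs) (trans (+-comm (cost ys) (cost xs)) (sym (cost-++ xs ys)))

find-anchor : ∀ ts → All (_≡ unhitˢ) ts ⊎ ∃₂ λ x t → ∃ λ y → ts ≡ x ++ t ∷ y × t ≢ unhitˢ
find-anchor []                    = inj₁ []
find-anchor (t@(S true) ∷ ts)      = inj₂ ([] , t , ts , refl , λ ())
find-anchor (t@(B _ _ _ _) ∷ ts)   = inj₂ ([] , t , ts , refl , λ ())
find-anchor (unhitˢ ∷ ts) with find-anchor ts
... | inj₁ all                   = inj₁ (refl ∷ all)
... | inj₂ (x , t , y , refl , ne) = inj₂ (unhitˢ ∷ x , t , y , refl , ne)

tiles-bounded : ∀ ts → Rigid ts → Bounded (flat ts)
tiles-bounded ts rigid big with find-anchor ts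
tiles-bounded _ rigid (s≤s ()) | inj₁ (refl ∷ [])
tiles-bounded _ rigid (s≤s (s≤s ())) | inj₁ (refl ∷ refl ∷ [])
tiles-bounded _ rigid (s≤s (s≤s (s≤s ()))) | inj₁ (refl ∷ refl ∷ refl ∷ [])
tiles-bounded (_ ∷ _ ∷ _ ∷ _ ∷ ts) rigid big | inj₁ (refl ∷ refl ∷ refl ∷ refl ∷ _) =
  ⊥-elim (¬rigid-unhit⁴ (rigid-factor [] (unhitˢ ∷ unhitˢ ∷ unhitˢ ∷ unhitˢ ∷ []) ts rigid))
... | inj₂ (x , t , y , refl , ne) = subst Bounded (sym (flat-++ x (t ∷ y))) (bounded-rotate (flat x)
        (subst Bounded (flat-++ (t ∷ y) x) (bound-from t (y ++ x) ne (rigid-rotate x (t ∷ y) rigid)))) big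

bounded-e₀ : ∀ cs → Walk e₀ (marks cs) e₀ → All Valid cs → Forces cs → Bounded cs
bounded-e₀ cs w ok f with ts , refl ← parse cs w ok = tiles-bounded ts f

bounded-after : ∀ {s} xs ys → Walk s (marks xs) e₀ → Walk e₀ (marks ys) s → All Valid (xs ++ ys) →
                Forces (xs ++ ys) → Bounded (xs ++ ys)
bounded-after xs ys w₁ w₂ ok f = bounded-rotate xs (bounded-e₀ (ys ++ xs)
  (subst (λ w → Walk e₀ w e₀) (sym (map-++ proj₂ ys xs)) (w₂ ++ʷ w₁))
  (All.++⁺ (All.++⁻ʳ xs ok) (All.++⁻ˡ xs ok)) (forces-rotate xs f))

-- The cut at position 0 may fall inside a block. Rotating by the rest of that block moves the cut
-- to e₀.
even-bounded : ∀ {s} cs → parity s ≡ false → Walk s (marks cs) s → All Valid cs → Forces cs → Bounded cs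
even-bounded {e₀} cs _ w ok f = bounded-e₀ cs w ok f
even-bounded {e₁} [] _ _ _ _ = λ ()
even-bounded {e₁} (c₁ ∷ c₂ ∷ c₃ ∷ cs) _ (e₁-rim ∷ e₂-path ∷ e₃-none ∷ w) =
  bounded-after (c₁ ∷ c₂ ∷ c₃ ∷ []) cs (e₁-rim ∷ e₂-path ∷ e₃-none ∷ []) w
even-bounded {e₂} [] _ _ _ _ = λ ()
even-bounded {e₂} (c₁ ∷ c₂ ∷ cs) _ (e₂-path ∷ e₃-none ∷ w) =
  bounded-after (c₁ ∷ c₂ ∷ []) cs (e₂-path ∷ e₃-none ∷ []) w
even-bounded {e₃} [] _ _ _ _ = λ ()
even-bounded {e₃} (c₁ ∷ cs) _ (e₃-none ∷ w) = bounded-after (c₁ ∷ []) cs (e₃-none ∷ []) w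
even-bounded {o₀} _ ()
even-bounded {o₁} _ ()
even-bounded {o₂} _ ()
even-bounded {o₃} _ ()

-- Words that attain the bound

pattern hitˢ = S true

-- It runs through `free₀`, `free₁`, `free₂`, `free₃`, `past₂`, `past₂S` and back, the only cycle of
-- the scan without loss.
period : List Tile
period = unhitˢ ∷ unhitˢ ∷ unhitˢ ∷ right₂ᴮ ∷ unhitˢ ∷ left₂ᴮ ∷ []

-- Found by search: with a leading unhit spoke, `rest r` has length 11 + r and (18 + r) / 6 hits.
rest : Fin 12 → List Tile
rest 0F = hitˢ ∷ right₂ᴮ ∷ unhitˢ ∷ left₂ᴮ ∷ []
rest 1F = unhitˢ ∷ hitˢ ∷ right₂ᴮ ∷ unhitˢ ∷ left₂ᴮ ∷ []
rest 2F = unhitˢ ∷ unhitˢ ∷ hitˢ ∷ right₂ᴮ ∷ unhitˢ ∷ left₂ᴮ ∷ []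
rest 3F = unhitˢ ∷ unhitˢ ∷ hitˢ ∷ unhitˢ ∷ right₂ᴮ ∷ unhitˢ ∷ left₂ᴮ ∷ []
rest 4F = unhitˢ ∷ unhitˢ ∷ hitˢ ∷ unhitˢ ∷ unhitˢ ∷ right₂ᴮ ∷ unhitˢ ∷ left₂ᴮ ∷ []
rest 5F = unhitˢ ∷ unhitˢ ∷ hitˢ ∷ period
rest 6F = rest 2F ++ left₂ᴮ ∷ []
rest 7F = rest 3F ++ left₂ᴮ ∷ []
rest 8F = rest 4F ++ left₂ᴮ ∷ []
rest 9F = rest 5F ++ left₂ᴮ ∷ []
rest (Fin.suc 9F) = rest 5F ++ unhitˢ ∷ left₂ᴮ ∷ []
rest (Fin.suc (Fin.suc 9F)) =
  unhitˢ ∷ unhitˢ ∷ right₂ᴮ ∷ left₁ᴮ ∷ unhitˢ ∷ unhitˢ ∷ unhitˢ ∷ right₁ᴮ ∷ left₂ᴮ ∷ []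

-- The common leading spoke shows, without a case split on `r`, that the matching contains the spoke
-- at position 0 and so falls under the clause of `𝓜₁` with spokes.
base : Fin 12 → List Tile
base r = unhitˢ ∷ rest r

periods : ℕ → List Tile
periods zero    = []
periods (suc m) = period ++ periods m

_≟ʳ_ : (r r′ : Row) → Dec (r ≡ r′)
_≟ʳ_ = Vec-≡-dec Bool._≟_

strays : Row → List Cell → Row
strays r cs = proj₂ (stray (e₀ , r) cs)

others : List State
others = e₁ ∷ e₂ ∷ e₃ ∷ o₀ ∷ o₁ ∷ o₂ ∷ o₃ ∷ []

avoids : State → Row → Bool
avoids s r = not (r ∋ᵇ s)

-- A competing closed walk either starts in e₀ and leaves the marks, which this check excludes, or
-- starts elsewhere, which `reach-check` excludes: in each case the start is not among the possible
-- ends. A set that is fixed by `period` stays the same after any number of periods.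
strays-check : Row → Bool
strays-check r = avoids e₀ r ∧ ⌊ strays r (flat period) ≟ʳ r ⌋

reach-check : State → Row → Bool
reach-check s r = avoids s r ∧ ⌊ reach r (flat period) ≟ʳ r ⌋

base-strays : ∀ r → T (strays-check (strays ∅ (flat (base r))))
base-strays r = all-elim (λ r → strays-check (strays ∅ (flat (base r)))) (allFin 12) tt (∈-allFin r)

base-reach : ∀ r {s} → s ∈ˡ others → T (reach-check s (reach (only s) (flat (base r))))
base-reach r = all-elim (λ s → reach-check s (reach (only s) (flat (base r)))) others
  (all-elim (λ r → all (λ s → reach-check s (reach (only s) (flat (base r)))) others) (allFin 12) tt
    (∈-allFin r))

base-size : ∀ r → length (flat (base r)) ≡ 11 + toℕ r
base-size r = ≡ᵇ⇒≡ _ _ (all-elim (λ r → length (flat (base r)) ≡ᵇ 11 + toℕ r) (allFin 12) tt (∈-allFin r))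

-- With n = 11 + r the right side is the integer part of (n + 7) / 6, that is ⌈(n + 2) / 6⌉.
base-cost : ∀ r → cost (flat (base r)) ≡ (18 + toℕ r) /ⁿ 6
base-cost r = ≡ᵇ⇒≡ _ _
  (all-elim (λ r → cost (flat (base r)) ≡ᵇ (18 + toℕ r) /ⁿ 6) (allFin 12) tt (∈-allFin r))

periods-size : ∀ m → length (flat (periods m)) ≡ m * 12
periods-size zero    = refl
periods-size (suc m) = cong (12 +_) (periods-size m)

periods-cost : ∀ m → cost (flat (periods m)) ≡ m * 2
periods-cost zero    = refl
periods-cost (suc m) = cong (2 +_) (periods-cost m)

stray-state : ∀ {s t cs} r → Walk s (marks cs) t → proj₁ (stray (s , r) cs) ≡ t
stray-state {cs = []} r [] = refl
stray-state {cs = _ ∷ _} r (st ∷ w) with refl ← step-follow st = stray-state _ w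

strays-++ : ∀ r ts cs → strays r (flat ts ++ cs) ≡ strays (strays r (flat ts)) cs
strays-++ r ts cs = cong proj₂ (trans (foldl-++ stray₁ (e₀ , r) (flat ts) cs)
  (cong (λ s → stray (s , strays r (flat ts)) cs) (stray-state r (flat-walk ts))))

strays-periods : ∀ r m → strays r (flat period) ≡ r → strays r (flat (periods m)) ≡ r
strays-periods r zero    eq = refl
strays-periods r (suc m) eq = begin
  strays r (flat period ++ flat (periods m))        ≡⟨ strays-++ r period (flat (periods m)) ⟩
  strays (strays r (flat period)) (flat (periods m)) ≡⟨ cong (λ r → strays r (flat (periods m))) eq ⟩
  strays r (flat (periods m))                        ≡⟨ strays-periods r m eq ⟩
  r                                                  ∎
  where open ≡-Reasoning

reach-++ : ∀ r xs ys → reach r (xs ++ ys) ≡ reach (reach r xs) ys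
reach-++ = foldl-++ λ r c → advance (proj₁ c) r

reach-periods : ∀ r m → reach r (flat period) ≡ r → reach r (flat (periods m)) ≡ r
reach-periods r zero    eq = refl
reach-periods r (suc m) eq = begin
  reach r (flat period ++ flat (periods m))        ≡⟨ reach-++ r (flat period) (flat (periods m)) ⟩
  reach (reach r (flat period)) (flat (periods m)) ≡⟨ cong (λ r → reach r (flat (periods m))) eq ⟩
  reach r (flat (periods m))                       ≡⟨ reach-periods r m eq ⟩
  r                                                ∎
  where open ≡-Reasoning

state-cases : ∀ s → s ≡ e₀ ⊎ s ∈ˡ others
state-cases e₀ = inj₁ refl
state-cases e₁ = inj₂ (here refl)
state-cases e₂ = inj₂ (there (here refl))
state-cases e₃ = inj₂ (there (there (here refl)))
state-cases o₀ = inj₂ (there (there (there (here refl))))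
state-cases o₁ = inj₂ (there (there (there (there (here refl)))))
state-cases o₂ = inj₂ (there (there (there (there (there (here refl))))))
state-cases o₃ = inj₂ (there (there (there (there (there (there (here refl)))))))

avoids-sound : ∀ s r → T (avoids s r) → ¬ r ∋ s
avoids-sound s r a m with r ∋ᵇ s
avoids-sound s r () m | true
avoids-sound s r a () | false

optimal : Fin 12 → ℕ → List Cell
optimal r m = flat (base r) ++ flat (periods m)

optimal-walk : ∀ r m → Walk e₀ (marks (optimal r m)) e₀
optimal-walk r m = subst (λ w → Walk e₀ w e₀) (sym (map-++ proj₂ (flat (base r)) (flat (periods m))))
                     (flat-walk (base r) ++ʷ flat-walk (periods m))

optimal-forces : ∀ r m → Forces (optimal r m)
optimal-forces r m w (s , walk) compat with state-cases s
... | inj₁ refl with stray-complete ∅ (optimal-walk r m) walk compat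
...   | inj₁ exact = exact
...   | inj₂ i with a , stable ← Equivalence.to T-∧ (base-strays r)
      = ⊥-elim (avoids-sound e₀ (strays ∅ (flat (base r))) a (subst (_∋ e₀)
          (trans (strays-++ ∅ (base r) (flat (periods m))) (strays-periods _ m (toWitness stable))) i))
optimal-forces r m w (s , walk) compat | inj₂ other with a , stable ← Equivalence.to T-∧ (base-reach r other)
  = ⊥-elim (avoids-sound s (reach (only s) (flat (base r))) a (subst (_∋ s)
      (trans (reach-++ (only s) (flat (base r)) (flat (periods m))) (reach-periods _ m (toWitness stable)))
      (reach-complete (only s) walk compat (∋-only s))))

optimal-size : ∀ r m → length (optimal r m) ≡ 11 + toℕ r + m * 12
optimal-size r m = trans (length-++ (flat (base r))) (cong₂ _+_ (base-size r) (periods-size m))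

optimal-cost : ∀ r m → cost (optimal r m) ≡ (18 + toℕ r) /ⁿ 6 + m * 2
optimal-cost r m = trans (cost-++ (flat (base r)) _) (cong₂ _+_ (base-cost r) (periods-cost m))

optimal-valid : ∀ r m → Pointwise Compat (optimal r m) (marks (optimal r m))
optimal-valid r m = subst (Pointwise Compat _) (sym (map-++ proj₂ (flat (base r)) (flat (periods m))))
                      (flat-valid (base r) ++ᵖ flat-valid (periods m))

-- The matching condition at a vertex as a step of the automaton

_at_ : ∀ {n} → Subset n → Fin n → Bool
_at_ = Vec.lookup

data One : Bool → Bool → Bool → Set where
  first  : One true  false false
  second : One false true  false
  third  : One false false true

module _ {n} (M : Subset n) (Inc : Fin n → Set) (a b c : Fin n) (a≢b : a ≢ b) (a≢c : a ≢ c) (b≢c : b ≢ c)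
         (inc-a : Inc a) (inc-b : Inc b) (inc-c : Inc c) (cases : ∀ e → Inc e → e ≡ a ⊎ e ≡ b ⊎ e ≡ c) where

  private
    present : ∀ {e} → e ∈ M → M at e ≡ true
    present = []=⇒lookup

    absurd : ∀ {e} {A : Set} → M at e ≡ false → e ∈ M → A
    absurd {e} off on with () ← trans (sym off) (present on)

    off : ∀ {e f} → (∀ {g} → g ∈ M × Inc g → e ≡ g) → Inc f → e ≢ f → M at f ≡ false
    off {f = f} uniq i ne with M at f in eq
    ... | true  = ⊥-elim (ne (uniq (lookup⇒[]= f M eq , i)))
    ... | false = refl

  unique⇒one : (∃! _≡_ λ e → e ∈ M × Inc e) → One (M at a) (M at b) (M at c)
  unique⇒one (e , (on , inc) , uniq) with cases _ inc
  ... | inj₁ refl        rewrite present on | off uniq inc-b a≢b | off uniq inc-c a≢c = first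
  ... | inj₂ (inj₁ refl) rewrite present on | off uniq inc-a (a≢b ∘ sym) | off uniq inc-c b≢c = second
  ... | inj₂ (inj₂ refl) rewrite present on | off uniq inc-a (a≢c ∘ sym) | off uniq inc-b (b≢c ∘ sym) = third

  one⇒unique : One (M at a) (M at b) (M at c) → ∃! _≡_ λ e → e ∈ M × Inc e
  one⇒unique one with M at a in eqa | M at b in eqb | M at c in eqc
  one⇒unique first | _ | _ | _ = a , (lookup⇒[]= a M eqa , inc-a) , λ (on , inc) → matches (cases _ inc) on
    where
    matches : ∀ {e} → e ≡ a ⊎ e ≡ b ⊎ e ≡ c → e ∈ M → a ≡ e
    matches (inj₁ refl)        on = refl
    matches (inj₂ (inj₁ refl)) on = absurd eqb on
    matches (inj₂ (inj₂ refl)) on = absurd eqc on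
  one⇒unique second | _ | _ | _ = b , (lookup⇒[]= b M eqb , inc-b) , λ (on , inc) → matches (cases _ inc) on
    where
    matches : ∀ {e} → e ≡ a ⊎ e ≡ b ⊎ e ≡ c → e ∈ M → b ≡ e
    matches (inj₁ refl)        on = absurd eqa on
    matches (inj₂ (inj₁ refl)) on = refl
    matches (inj₂ (inj₂ refl)) on = absurd eqc on
  one⇒unique third | _ | _ | _ = c , (lookup⇒[]= c M eqc , inc-c) , λ (on , inc) → matches (cases _ inc) on
    where
    matches : ∀ {e} → e ≡ a ⊎ e ≡ b ⊎ e ≡ c → e ∈ M → c ≡ e
    matches (inj₁ refl)        on = absurd eqa on
    matches (inj₂ (inj₁ refl)) on = absurd eqb on
    matches (inj₂ (inj₂ refl)) on = refl

-- `One p s a` is the condition at u_i and `One r s b` that at v_i. They share the spoke, which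
-- leaves five joint choices; the free bit `q` doubles them to the ten steps.
one⇒step : ∀ {p q r a s b} → One p s a → One r s b → Step ⟦ p , q , r ⟧ ⟨ a , s , b ⟩ ⟦ q , a , b ⟧
one⇒step {q = false} first  first  = e₃-none
one⇒step {q = true}  first  first  = o₃-none
one⇒step {q = false} first  third  = o₀-path
one⇒step {q = true}  first  third  = e₂-path
one⇒step {q = false} second second = e₀-rung
one⇒step {q = true}  second second = o₂-rung
one⇒step {q = false} third  first  = o₁-rim
one⇒step {q = true}  third  first  = e₁-rim
one⇒step {q = false} third  third  = e₀-both
one⇒step {q = true}  third  third  = o₂-both

step⇒one : ∀ {p q r a s b t} → Step ⟦ p , q , r ⟧ ⟨ a , s , b ⟩ t → One p s a × One r s b
step⇒one e₀-rung = second , second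
step⇒one e₀-both = third , third
step⇒one e₁-rim  = third , first
step⇒one e₂-path = first , third
step⇒one e₃-none = first , first
step⇒one o₀-path = first , third
step⇒one o₁-rim  = third , first
step⇒one o₂-rung = second , second
step⇒one o₂-both = third , third
step⇒one o₃-none = first , first

-- Sequences of letters

-- This is the state before position k + 2; the shift by two avoids subtraction.
stateAt : (ℕ → Letter) → ℕ → State
stateAt F k = ⟦ uuᵇ (F k) , uuᵇ (F (1 + k)) , vvᵇ (F (1 + k)) ⟧

Local : (ℕ → Letter) → ℕ → Set
Local F k = Step (stateAt F k) (F (2 + k)) (stateAt F (1 + k))

local⇒walk : ∀ F m → (∀ k → Local F k) → Walk (stateAt F 0) (applyUpTo (F ∘ (2 +_)) m) (stateAt F m)
local⇒walk F zero    loc = []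
local⇒walk F (suc m) loc = loc 0 ∷ local⇒walk (F ∘ suc) m (loc ∘ suc)

-- The start of the walk is unknown, but two letters determine the state after them, so the
-- condition is found at the third.
walk⇒local : ∀ F m k {s t} → Walk s (applyUpTo F m) t → 2 + k < m → Local F k
walk⇒local F (suc (suc zero)) zero _ (s≤s (s≤s ()))
walk⇒local F (suc (suc (suc m))) zero (a ∷ b ∷ c ∷ _) _
  with refl ← step-follow a | refl ← step-follow b | refl ← step-follow c = c
walk⇒local F (suc m) (suc k) (_ ∷ w) (s≤s lt) = walk⇒local (F ∘ suc) m k w lt

applyUpTo-cong : ∀ {A : Set} {f g : ℕ → A} m → (∀ k → f k ≡ g k) → applyUpTo f m ≡ applyUpTo g m
applyUpTo-cong zero    eq = refl
applyUpTo-cong (suc m) eq = cong₂ _∷_ (eq 0) (applyUpTo-cong m (eq ∘ suc))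

applyUpTo-++ : ∀ {A : Set} (f : ℕ → A) a b → applyUpTo f (a + b) ≡ applyUpTo f a ++ applyUpTo (f ∘ (a +_)) b
applyUpTo-++ f zero    b = refl
applyUpTo-++ f (suc a) b = cong (f 0 ∷_) (applyUpTo-++ (f ∘ suc) a b)

tabulate-applyUpTo : ∀ {A : Set} n (f : Fin n → A) (g : ℕ → A) → (∀ i → f i ≡ g (toℕ i)) →
                     tabulate f ≡ applyUpTo g n
tabulate-applyUpTo zero    f g eq = refl
tabulate-applyUpTo (suc n) f g eq = cong₂ _∷_ (eq zero) (tabulate-applyUpTo n (f ∘ suc) (g ∘ suc) (eq ∘ suc))

tabulated : ∀ {A : Set} {n} (w : List A) → length w ≡ n → ∃ λ (f : Fin n → A) → w ≡ tabulate f
tabulated w refl = List.lookup w , sym (tabulate-lookup w)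

-- Edge sets as words

imp-⇒ : ∀ {x y} → T (imp x y) → x ≡ true → y ≡ true
imp-⇒ {true} {true} _ _ = refl

⇒-imp : ∀ {x y} → (x ≡ true → y ≡ true) → T (imp x y)
⇒-imp {true}  f = subst T (sym (f refl)) tt
⇒-imp {false} f = tt

⊑-refl : ∀ l → l ⊑ l
⊑-refl none = tt
⊑-refl rim  = tt
⊑-refl rung = tt
⊑-refl path = tt
⊑-refl both = tt
⊑-refl ⟨ true  , true  , false ⟩ = tt
⊑-refl ⟨ false , true  , true  ⟩ = tt
⊑-refl ⟨ true  , true  , true  ⟩ = tt

card-++ : ∀ {a b} (X : Subset a) (Y : Subset b) → ∥ X Vec.++ Y ∥ ≡ ∥ X ∥ + ∥ Y ∥
card-++ []          Y = refl
card-++ (true ∷ X)  Y = cong suc (card-++ X Y)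
card-++ (false ∷ X) Y = card-++ X Y

card-∷ : ∀ {n} x (X : Subset n) → ∥ x ∷ X ∥ ≡ bit x + ∥ X ∥
card-∷ true  X = refl
card-∷ false X = refl

cost-tabulate : ∀ n (f : Fin n → Letter) (g : Fin n → Letter) →
  ∥ Vec.tabulate (uuᵇ ∘ f) ∥ + (∥ Vec.tabulate (spokeᵇ ∘ f) ∥ + ∥ Vec.tabulate (vvᵇ ∘ f) ∥) ≡
  cost (tabulate λ i → f i , g i)
cost-tabulate zero f g = refl
cost-tabulate (suc n) f g
  rewrite card-∷ (uuᵇ (f zero)) (Vec.tabulate (uuᵇ ∘ f ∘ suc))
        | card-∷ (spokeᵇ (f zero)) (Vec.tabulate (spokeᵇ ∘ f ∘ suc))
        | card-∷ (vvᵇ (f zero)) (Vec.tabulate (vvᵇ ∘ f ∘ suc)) | sym (cost-tabulate n (f ∘ suc) (g ∘ suc))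
  = solve 6 (λ a x b y c z → (a :+ x) :+ ((b :+ y) :+ (c :+ z)) := (a :+ (b :+ c)) :+ (x :+ (y :+ z))) refl
      (bit (uuᵇ (f zero))) (∥ Vec.tabulate (uuᵇ ∘ f ∘ suc) ∥)
      (bit (spokeᵇ (f zero))) (∥ Vec.tabulate (spokeᵇ ∘ f ∘ suc) ∥)
      (bit (vvᵇ (f zero))) (∥ Vec.tabulate (vvᵇ ∘ f ∘ suc) ∥)
  where
  open +-*-Solver

module Edges (n : ℕ) where

  letter : Subset (3 * n) → Fin n → Letter
  letter X i = ⟨ X at uu i , X at spoke i , X at vv i ⟩

  fromLetters : (Fin n → Letter) → Subset (3 * n)
  fromLetters f = Vec.concat (Vec.tabulate (uuᵇ ∘ f) ∷ Vec.tabulate (spokeᵇ ∘ f) ∷ Vec.tabulate (vvᵇ ∘ f) ∷ [])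

  letter-fromLetters : ∀ (f : Fin n → Letter) i → letter (fromLetters f) i ≡ f i
  letter-fromLetters f i = trans (cong (λ a → ⟨ a , fromLetters f at spoke i , fromLetters f at vv i ⟩) (entry 0F))
      (cong₂ (λ s b → ⟨ uuᵇ (f i) , s , b ⟩) (entry 1F) (entry 2F))
    where
    rows : Vec (Vec Bool n) 3
    rows = Vec.tabulate (uuᵇ ∘ f) ∷ Vec.tabulate (spokeᵇ ∘ f) ∷ Vec.tabulate (vvᵇ ∘ f) ∷ []
    value : Fin 3 → Bool
    value 0F = uuᵇ (f i)
    value 1F = spokeᵇ (f i)
    value 2F = vvᵇ (f i)
    row : ∀ (t : Fin 3) → Vec.lookup (Vec.lookup rows t) i ≡ value t
    row 0F = lookup∘tabulate (uuᵇ ∘ f) i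
    row 1F = lookup∘tabulate (spokeᵇ ∘ f) i
    row 2F = lookup∘tabulate (vvᵇ ∘ f) i
    entry : ∀ (t : Fin 3) → fromLetters f at combine t i ≡ value t
    entry t = trans (lookup-concat rows t i) (row t)

  ⊑⇒⊆ : ∀ {X Y : Subset (3 * n)} → (∀ i → letter X i ⊑ letter Y i) → X ⊆ Y
  ⊑⇒⊆ {X} {Y} le {e} e∈X = subst (_∈ Y) (combine-remQuot {3} n e)
      (go (remQuot n e) (subst (_∈ X) (sym (combine-remQuot {3} n e)) e∈X))
    where
    go : ∀ ((t , i) : Fin 3 × Fin n) → combine t i ∈ X → combine t i ∈ Y
    go (t , i) on with a , bc ← Equivalence.to T-∧ (le i) with b , c ← Equivalence.to T-∧ bc
      = lookup⇒[]= _ Y (pick t ([]=⇒lookup on))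
      where
      pick : ∀ (t : Fin 3) → X at combine t i ≡ true → Y at combine t i ≡ true
      pick 0F = imp-⇒ a
      pick 1F = imp-⇒ b
      pick 2F = imp-⇒ c

  ⊆⇒⊑ : ∀ {X Y : Subset (3 * n)} → X ⊆ Y → ∀ i → letter X i ⊑ letter Y i
  ⊆⇒⊑ {X} {Y} sub i = Equivalence.from T-∧ (entry 0F , Equivalence.from T-∧ (entry 1F , entry 2F))
    where
    entry : ∀ (t : Fin 3) → T (imp (X at combine t i) (Y at combine t i))
    entry t = ⇒-imp λ on → []=⇒lookup (sub (lookup⇒[]= (combine t i) X on))

  letters-injective : ∀ {X Y : Subset (3 * n)} → (∀ i → letter X i ≡ letter Y i) → X ≡ Y
  letters-injective {X = X} {Y} eq = ⊆-antisym
    (⊑⇒⊆ λ i → subst (letter X i ⊑_) (eq i) (⊑-refl (letter X i)))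
    (⊑⇒⊆ λ i → subst (_⊑ letter X i) (eq i) (⊑-refl (letter X i)))

  cellAt : (H M : Subset (3 * n)) → Fin n → Cell
  cellAt H M i = letter H i , letter M i

  cellsOf : (H M : Subset (3 * n)) → List Cell
  cellsOf H M = tabulate (cellAt H M)

  card-cost : ∀ (H M : Subset (3 * n)) → ∥ H ∥ ≡ cost (cellsOf H M)
  card-cost H M = begin
    ∥ H ∥                          ≡⟨ cong ∥_∥ rebuild ⟩
    ∥ X Vec.++ (Y Vec.++ (Z Vec.++ [])) ∥ ≡⟨ card-++ X (Y Vec.++ (Z Vec.++ [])) ⟩
    ∥ X ∥ + ∥ Y Vec.++ (Z Vec.++ []) ∥    ≡⟨ cong (∥ X ∥ +_) (card-++ Y (Z Vec.++ [])) ⟩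
    ∥ X ∥ + (∥ Y ∥ + ∥ Z Vec.++ [] ∥)     ≡⟨ cong (λ c → ∥ X ∥ + (∥ Y ∥ + c)) (trans (card-++ Z []) (+-identityʳ ∥ Z ∥)) ⟩
    ∥ X ∥ + (∥ Y ∥ + ∥ Z ∥)               ≡⟨ cost-tabulate n (letter H) (letter M) ⟩
    cost (cellsOf H M)                    ∎
    where
    open ≡-Reasoning
    rebuild : H ≡ fromLetters (letter H)
    rebuild = letters-injective λ i → sym (letter-fromLetters (letter H) i)
    X Y Z : Subset n
    X = Vec.tabulate (uuᵇ ∘ letter H)
    Y = Vec.tabulate (spokeᵇ ∘ letter H)
    Z = Vec.tabulate (vvᵇ ∘ letter H)

-- Perfect matchings as closed walks

module Cyclic (k : ℕ) (3≤k : 3 ≤ k) where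

  -- In this form, going back by two positions is the offset `k`, and `stateAt F k` is the state
  -- before position n, that is, before position 0.
  n : ℕ
  n = 2 + k

  open Edges n

  private
    simple : IsSimple (P n)
    simple = P-isSimple n (s≤s (s≤s 3≤k))

  pos : ℕ → Fin n
  pos j = j mod n

  toℕ-pos : ∀ j → toℕ (pos j) ≡ j % n
  toℕ-pos j = toℕ-fromℕ< (m%n<n j n)

  pos-toℕ : ∀ i → pos (toℕ i) ≡ i
  pos-toℕ i = toℕ-injective (trans (toℕ-pos (toℕ i)) (m<n⇒m%n≡m (toℕ<n i)))

  pos-⊕ : ∀ j m → pos j ⊕ m ≡ pos (j + m)
  pos-⊕ j m = toℕ-injective (begin
    toℕ (pos j ⊕ m)           ≡⟨ toℕ-pos (toℕ (pos j) + m) ⟩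
    (toℕ (pos j) + m) % n     ≡⟨ cong (λ a → (a + m) % n) (toℕ-pos j) ⟩
    (j % n + m) % n           ≡⟨ %-distribˡ-+ (j % n) m n ⟩
    (j % n % n + m % n) % n   ≡⟨ cong (λ a → (a + m % n) % n) (m%n%n≡m%n j n) ⟩
    (j % n + m % n) % n       ≡⟨ %-distribˡ-+ j m n ⟨
    (j + m) % n               ≡⟨ toℕ-pos (j + m) ⟨
    toℕ (pos (j + m))         ∎)
    where open ≡-Reasoning

  pos-+n : ∀ j → pos (j + n) ≡ pos j
  pos-+n j = toℕ-injective (trans (toℕ-pos (j + n)) (trans ([m+n]%n≡m%n j n) (sym (toℕ-pos j))))

  pos-n+ : ∀ j → pos (n + j) ≡ pos j
  pos-n+ j = trans (cong pos (+-comm n j)) (pos-+n j)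

  pos-wrap : ∀ a b j → a + b ≡ n → pos ((a + j) + b) ≡ pos j
  pos-wrap a b j eq = trans (cong pos (begin
    (a + j) + b ≡⟨ cong (_+ b) (+-comm a j) ⟩
    (j + a) + b ≡⟨ +-assoc j a b ⟩
    j + (a + b) ≡⟨ cong (j +_) eq ⟩
    j + n       ∎)) (pos-+n j)
    where open ≡-Reasoning

  ⊕-⊕ : ∀ i a b → i ⊕ a ⊕ b ≡ i ⊕ (a + b)
  ⊕-⊕ i a b rewrite sym (pos-toℕ i) = begin
    pos j ⊕ a ⊕ b     ≡⟨ cong (_⊕ b) (pos-⊕ j a) ⟩
    pos (j + a) ⊕ b   ≡⟨ pos-⊕ (j + a) b ⟩
    pos (j + a + b)   ≡⟨ cong pos (+-assoc j a b) ⟩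
    pos (j + (a + b)) ≡⟨ pos-⊕ j (a + b) ⟨
    pos j ⊕ (a + b)   ∎
    where
    open ≡-Reasoning
    j = toℕ i

  ⊕-n : ∀ i → i ⊕ n ≡ i
  ⊕-n i = trans (pos-+n (toℕ i)) (pos-toℕ i)

  ⊕-cancel : ∀ {i j : Fin n} a b → a + b ≡ n → i ⊕ a ≡ j → i ≡ j ⊕ b
  ⊕-cancel {i} a b eq refl = sym (trans (⊕-⊕ i a b) (trans (cong (i ⊕_) eq) (⊕-n i)))

  ends : ∀ t i → Graph.ends (P n) (combine t i) ≡ endpoints (t , i)
  ends t i = cong endpoints (remQuot-combine {3} t i)

  Inc : Vertex n → Fin (3 * n) → Set
  Inc = Graph.Incident (P n)

  inc₁ : ∀ t i → Inc (proj₁ (endpoints (t , i))) (combine t i)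
  inc₁ t i = inj₁ (cong proj₁ (sym (ends t i)))

  inc₂ : ∀ t i → Inc (proj₂ (endpoints (t , i))) (combine t i)
  inc₂ t i = inj₂ (cong proj₂ (sym (ends t i)))

  edge-cases : ∀ x → (Q : Fin (3 * n) → Set) →
    (∀ t i → x ≡ proj₁ (endpoints (t , i)) ⊎ x ≡ proj₂ (endpoints (t , i)) → Q (combine t i)) →
    ∀ e → Inc x e → Q e
  edge-cases x Q f e inc = subst Q (combine-remQuot {3} n e) 
    (f (proj₁ (remQuot {3} n e)) (proj₂ (remQuot {3} n e)) inc)

  u-edges : ∀ j e → Inc (u (pos (2 + j))) e → e ≡ uu (pos j) ⊎ e ≡ spoke (pos (2 + j)) ⊎ e ≡ uu (pos (2 + j))
  u-edges j = edge-cases (u (pos (2 + j)))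
    (λ e → e ≡ uu (pos j) ⊎ e ≡ spoke (pos (2 + j)) ⊎ e ≡ uu (pos (2 + j))) cases
    where
    cases : ∀ t i →
      u (pos (2 + j)) ≡ proj₁ (endpoints (t , i)) ⊎ u (pos (2 + j)) ≡ proj₂ (endpoints (t , i)) →
      combine t i ≡ uu (pos j) ⊎ combine t i ≡ spoke (pos (2 + j)) ⊎ combine t i ≡ uu (pos (2 + j))
    cases 0F i (inj₁ refl) = inj₂ (inj₂ refl)
    cases 0F i (inj₂ eq)   = inj₁ (cong uu (trans (⊕-cancel {i} 2 k refl (u-inj (sym eq)))
                               (trans (pos-⊕ (2 + j) k) (pos-wrap 2 k j refl))))
      where
      u-inj : ∀ {i j : Fin n} → u i ≡ u j → i ≡ j
      u-inj refl = refl
    cases 1F i (inj₁ refl) = inj₂ (inj₁ refl)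
    cases 1F i (inj₂ ())
    cases 2F i (inj₁ ())
    cases 2F i (inj₂ ())

  v-edges : ∀ j e → Inc (v (pos (2 + j))) e → e ≡ vv (pos (1 + j)) ⊎ e ≡ spoke (pos (2 + j)) ⊎ e ≡ vv (pos (2 + j))
  v-edges j = edge-cases (v (pos (2 + j)))
    (λ e → e ≡ vv (pos (1 + j)) ⊎ e ≡ spoke (pos (2 + j)) ⊎ e ≡ vv (pos (2 + j))) cases
    where
    cases : ∀ t i →
      v (pos (2 + j)) ≡ proj₁ (endpoints (t , i)) ⊎ v (pos (2 + j)) ≡ proj₂ (endpoints (t , i)) →
      combine t i ≡ vv (pos (1 + j)) ⊎ combine t i ≡ spoke (pos (2 + j)) ⊎ combine t i ≡ vv (pos (2 + j))
    cases 1F i (inj₂ refl) = inj₂ (inj₁ refl)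
    cases 2F i (inj₁ refl) = inj₂ (inj₂ refl)
    cases 2F i (inj₂ eq)   = inj₁ (cong vv (trans (⊕-cancel {i} 1 (1 + k) refl (v-inj (sym eq)))
                               (trans (pos-⊕ (2 + j) (1 + k)) (pos-wrap 1 (1 + k) (1 + j) refl))))
      where
      v-inj : ∀ {i j : Fin n} → v i ≡ v j → i ≡ j
      v-inj refl = refl

  combine-≢ : ∀ t t′ {i i′} → t ≢ t′ → combine {3} {n} t i ≢ combine t′ i′
  combine-≢ t t′ {i} {i′} ne eq = ne (combine-injectiveˡ t i t′ i′ eq)

  uu-≢ : ∀ j → uu (pos j) ≢ uu (pos (2 + j))
  uu-≢ j eq = IsSimple.loopless simple (uu (pos j)) (trans (cong proj₁ (ends 0F (pos j)))
    (trans (cong u (trans (combine-injectiveʳ {3} 0F (pos j) 0F (pos (2 + j)) eq)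
      (trans (cong pos (+-comm 2 j)) (sym (pos-⊕ j 2)))))
    (sym (cong proj₂ (ends 0F (pos j))))))

  vv-≢ : ∀ j → vv (pos j) ≢ vv (pos (1 + j))
  vv-≢ j eq = IsSimple.loopless simple (vv (pos j)) (trans (cong proj₁ (ends 2F (pos j)))
    (trans (cong v (trans (combine-injectiveʳ {3} 2F (pos j) 2F (pos (1 + j)) eq)
      (trans (cong pos (+-comm 1 j)) (sym (pos-⊕ j 1)))))
    (sym (cong proj₂ (ends 2F (pos j))))))

  inc-uu : ∀ j → Inc (u (pos (2 + j))) (uu (pos j))
  inc-uu j = subst (λ i → Inc (u i) (uu (pos j))) (trans (pos-⊕ j 2) (cong pos (+-comm j 2))) (inc₂ 0F (pos j))

  inc-vv : ∀ j → Inc (v (pos (1 + j))) (vv (pos j))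
  inc-vv j = subst (λ i → Inc (v i) (vv (pos j))) (trans (pos-⊕ j 1) (cong pos (+-comm j 1))) (inc₂ 2F (pos j))

  letters : Subset (3 * n) → ℕ → Letter
  letters M j = letter M (pos j)

  perfect⇒local : ∀ M → PerfectMatching (P n) M → ∀ j → Local (letters M) j
  perfect⇒local M pm j = one⇒step
    (unique⇒one M (Inc (u (pos (2 + j)))) (uu (pos j)) (spoke (pos (2 + j))) (uu (pos (2 + j)))
      (combine-≢ 0F 1F λ ()) (uu-≢ j) (combine-≢ 1F 0F λ ())
      (inc-uu j) (inc₁ 1F _) (inc₁ 0F _) (u-edges j) (pm (u (pos (2 + j)))))
    (unique⇒one M (Inc (v (pos (2 + j)))) (vv (pos (1 + j))) (spoke (pos (2 + j))) (vv (pos (2 + j)))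
      (combine-≢ 2F 1F λ ()) (vv-≢ (1 + j)) (combine-≢ 1F 2F λ ())
      (inc-vv (1 + j)) (inc₂ 1F _) (inc₁ 2F _) (v-edges j) (pm (v (pos (2 + j)))))

  pos-shift : ∀ i → pos (2 + (k + toℕ i)) ≡ i
  pos-shift i = trans (pos-n+ (toℕ i)) (pos-toℕ i)

  local⇒perfect : ∀ M → (∀ i → Local (letters M) (k + toℕ {n} i)) → PerfectMatching (P n) M
  local⇒perfect M loc (u i) = subst (λ i → ∃! _≡_ λ e → e ∈ M × Inc (u i) e) (pos-shift i)
    (one⇒unique M (Inc (u (pos (2 + j)))) (uu (pos j)) (spoke (pos (2 + j))) (uu (pos (2 + j)))
      (combine-≢ 0F 1F λ ()) (uu-≢ j) (combine-≢ 1F 0F λ ())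
      (inc-uu j) (inc₁ 1F _) (inc₁ 0F _) (u-edges j) (proj₁ (step⇒one (loc i))))
    where j = k + toℕ i
  local⇒perfect M loc (v i) = subst (λ i → ∃! _≡_ λ e → e ∈ M × Inc (v i) e) (pos-shift i)
    (one⇒unique M (Inc (v (pos (2 + j)))) (vv (pos (1 + j))) (spoke (pos (2 + j))) (vv (pos (2 + j)))
      (combine-≢ 2F 1F λ ()) (vv-≢ (1 + j)) (combine-≢ 1F 2F λ ())
      (inc-vv (1 + j)) (inc₂ 1F _) (inc₁ 2F _) (v-edges j) (proj₂ (step⇒one (loc i))))
    where j = k + toℕ i

  word : Subset (3 * n) → List Letter
  word M = tabulate (letter M)

  word-letters : ∀ M → word M ≡ applyUpTo (letters M) n
  word-letters M = tabulate-applyUpTo n (letter M) (letters M) λ i → cong (letter M) (sym (pos-toℕ i))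

  perfect⇒walk : ∀ M → PerfectMatching (P n) M → Walk (stateAt (letters M) k) (word M) (stateAt (letters M) k)
  perfect⇒walk M pm = subst₂ (Walk (stateAt F k)) wd st
                        -- The sequence is shifted by `k` so that the first letter read is the one
                        -- at position 2 + k = n, which is position 0.
                        (local⇒walk (F ∘ (_+ k)) n λ j → perfect⇒local M pm (j + k))
    where
    F = letters M
    wd : applyUpTo (F ∘ (_+ k) ∘ (2 +_)) n ≡ word M
    wd = trans (applyUpTo-cong n λ j → cong (letter M)
                 (trans (cong (λ a → pos (2 + a)) (+-comm j k)) (pos-n+ j)))
               (sym (word-letters M))
    st : stateAt (F ∘ (_+ k)) n ≡ stateAt F k
    st = cong₂ (λ a b → ⟦ uuᵇ (letter M a) , uuᵇ (letter M b) , vvᵇ (letter M b) ⟧)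
           (pos-n+ k) (trans (cong pos (sym (+-suc n k))) (pos-n+ (suc k)))

  -- A condition involves three consecutive letters, so those across the seam are read off two
  -- rounds of the closed walk: the condition at position i is taken at n + i.
  walk⇒perfect : ∀ M → Closed (word M) → PerfectMatching (P n) M
  walk⇒perfect M (s , w) = local⇒perfect M λ i →
      walk⇒local F (n + n) (k + toℕ i) (subst (λ x → Walk s x s) twice (w ++ʷ w)) (+-monoʳ-< n (toℕ<n i))
    where
    F = letters M
    twice : word M ++ word M ≡ applyUpTo F (n + n)
    twice = sym (trans (applyUpTo-++ F n n) (cong₂ _++_ (sym (word-letters M))
      (trans (applyUpTo-cong n λ j → cong (letter M) (pos-n+ j)) (sym (word-letters M)))))

  letters-word : ∀ (f : Fin n → Letter) → word (fromLetters f) ≡ tabulate f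
  letters-word f = tabulate-cong (letter-fromLetters f)

  marks-cells : ∀ H M → marks (cellsOf H M) ≡ word M
  marks-cells H M = map-tabulate (cellAt H M) proj₂

  forcing⇒forces : ∀ {M H} → IsForcingSet (P n) M H → Forces (cellsOf H M)
  forcing⇒forces {M} {H} (_ , only) w closed compat
    with f , refl ← tabulated {n = n} w (trans (sym (Pointwise-length compat)) (length-tabulate (cellAt H M)))
    = tabulate⁺ {f = cellAt H M} {g = f} λ i → trans (sym (letter-fromLetters f i)) (cong (λ X → letter X i) same)
    where
    same : fromLetters f ≡ M
    same = only (fromLetters f) (walk⇒perfect _ (subst Closed (sym (letters-word f)) closed))
             (⊑⇒⊆ λ i → subst (letter H i ⊑_) (sym (letter-fromLetters f i))
               (tabulate⁻ {f = cellAt H M} {g = f} compat i))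

  forces⇒forcing : ∀ {M H} → H ⊆ M → Forces (cellsOf H M) → IsForcingSet (P n) M H
  forces⇒forcing {M} {H} H⊆M forces = H⊆M , λ M′ pm H⊆M′ → letters-injective
    (tabulate⁻ {f = cellAt H M} {g = letter M′}
      (forces (word M′) (_ , perfect⇒walk M′ pm)
        (tabulate⁺ {f = cellAt H M} {g = letter M′} (⊆⇒⊑ {H} {M′} H⊆M′))))

-- The class `𝓜₁` and the even half

-- In the notation ⟦ p , q , r ⟧ and ⟨ a , s , b ⟩, both p + a and r + b equal 1 - s because u_i and
-- v_i share the spoke. So p + r and a + b have equal parity, and q is common to both states.
step-parity : ∀ {s l t} → Step s l t → parity s ≡ parity t
step-parity e₀-rung = refl
step-parity e₀-both = refl
step-parity e₁-rim  = refl
step-parity e₂-path = refl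
step-parity e₃-none = refl
step-parity o₀-path = refl
step-parity o₁-rim  = refl
step-parity o₂-rung = refl
step-parity o₂-both = refl
step-parity o₃-none = refl

spoke-even : ∀ {s l t} → Step s l t → spokeᵇ l ≡ true → parity s ≡ false → t ≡ e₀
spoke-even e₀-rung _ _ = refl
spoke-even o₂-rung _ ()

spoke-odd : ∀ {s l t} → Step s l t → spokeᵇ l ≡ true → parity s ≡ true → t ≡ o₀
spoke-odd o₂-rung _ _ = refl
spoke-odd e₀-rung _ ()

-- After a spoke the spokeless steps are forced and have period four. The next spoke can occur only
-- at e₀ or at o₂, so the gaps are 0 modulo 4 in the even half and 2 modulo 4 in the odd half.
evenPhase oddPhase : ℕ → State
evenPhase 0 = e₀
evenPhase 1 = e₁
evenPhase 2 = e₂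
evenPhase 3 = e₃
evenPhase (suc (suc (suc (suc d)))) = evenPhase d
oddPhase 0 = o₀
oddPhase 1 = o₁
oddPhase 2 = o₂
oddPhase 3 = o₃
oddPhase (suc (suc (suc (suc d)))) = oddPhase d

NextPhase : (ℕ → State) → Set
NextPhase phase = ∀ d {l t} → Step (phase d) l t → spokeᵇ l ≡ false → t ≡ phase (suc d)

evenPhase-next : NextPhase evenPhase
evenPhase-next 0 e₀-both _ = refl
evenPhase-next 1 e₁-rim  _ = refl
evenPhase-next 2 e₂-path _ = refl
evenPhase-next 3 e₃-none _ = refl
evenPhase-next (suc (suc (suc (suc d)))) = evenPhase-next d

oddPhase-next : NextPhase oddPhase
oddPhase-next 0 o₀-path _ = refl
oddPhase-next 1 o₁-rim  _ = refl
oddPhase-next 2 o₂-both _ = refl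
oddPhase-next 3 o₃-none _ = refl
oddPhase-next (suc (suc (suc (suc d)))) = oddPhase-next d

evenPhase-spoke : ∀ d {l t} → Step (evenPhase d) l t → spokeᵇ l ≡ true → d % 4 ≡ 0
evenPhase-spoke 0 _ _ = refl
evenPhase-spoke 1 e₁-rim  ()
evenPhase-spoke 2 e₂-path ()
evenPhase-spoke 3 e₃-none ()
evenPhase-spoke (suc (suc (suc (suc d)))) st on =
  trans (cong (_% 4) (+-comm 4 d)) (trans ([m+n]%n≡m%n d 4) (evenPhase-spoke d st on))

oddPhase-spoke : ∀ q {l t} → Step (oddPhase (q * 4)) l t → spokeᵇ l ≢ true
oddPhase-spoke zero    o₀-path ()
oddPhase-spoke (suc q) st = oddPhase-spoke q st

least : ∀ (p : ℕ → Bool) m → p m ≡ true → ∃ λ d → d ≤ m × p d ≡ true × (∀ j → j < d → p j ≡ false)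
least p zero    on = 0 , z≤n , on , λ _ ()
least p (suc m) on with p 0 in eq
... | true  = 0 , z≤n , eq , λ _ ()
... | false with d , d≤m , at-d , before ← least (p ∘ suc) m on = suc d , s≤s d≤m , at-d , earlier
  where
  earlier : ∀ j → j < suc d → p j ≡ false
  earlier zero    _        = eq
  earlier (suc j) (s≤s lt) = before j lt

∈-first-⋃ : ∀ {N x} (f : ℕ → Subset N) m → 0 < m → x ∈ f 0 → x ∈ ⋃ (map f (upTo m))
∈-first-⋃ f (suc m) _ i = x∈p∪q⁺ (inj₁ i)

walk-end : ∀ F m {s t} → Walk s (applyUpTo F (2 + m)) t → t ≡ stateAt F m
walk-end F zero (a ∷ b ∷ []) with refl ← step-follow a | refl ← step-follow b = refl
walk-end F (suc m) (_ ∷ w) = walk-end (F ∘ suc) m w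

module Shape (k : ℕ) (9≤k : 9 ≤ k) where

  open Cyclic k (≤-trans (≤ᵇ⇒≤ 3 9 tt) 9≤k) public
  open Edges (2 + k) public

  ∉⇒false : ∀ {M : Subset (3 * n)} {e} → e ∉ M → M at e ≡ false
  ∉⇒false {M} {e} off with M at e in eq
  ... | true  = ⊥-elim (off (lookup⇒[]= e M eq))
  ... | false = refl

  module _ {M : Subset (3 * n)} (pm : PerfectMatching (P n) M) where

    F : ℕ → Letter
    F = letters M

    local : ∀ j → Local F j
    local = perfect⇒local M pm

    parity-+ : ∀ j → parity (stateAt F (j + k)) ≡ parity (stateAt F k)
    parity-+ zero    = refl
    parity-+ (suc j) = trans (sym (step-parity (local (j + k)))) (parity-+ j)

    -- The state before position i is stateAt F (before i).
    before : Fin n → ℕ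
    before i = toℕ i + k

    pos-before : ∀ i → pos (2 + before i) ≡ i
    pos-before i = trans (cong (λ a → pos (2 + a)) (+-comm (toℕ i) k)) (pos-shift i)

    letter-before : ∀ i d → letter M (i ⊕ d) ≡ F (2 + (before i + d))
    letter-before i d = cong (letter M) (trans (cong (_⊕ d) (sym (pos-before i))) (pos-⊕ (2 + before i) d))

    phases : ∀ {phase} → NextPhase phase → ∀ i → stateAt F (before i + 1) ≡ phase 0 →
             ∀ d → (∀ m → m < d → M at spoke (i ⊕ suc m) ≡ false) → stateAt F (before i + suc d) ≡ phase d
    phases next i initial zero    off = initial
    phases {phase} next i initial (suc d) off = trans (cong (stateAt F) (+-suc (before i) (suc d)))
      (next d (subst (λ s → Step s (F (2 + (before i + suc d))) (stateAt F (1 + (before i + suc d))))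
                     (phases next i initial d λ m lt → off m (m<n⇒m<1+n lt)) (local (before i + suc d)))
              (trans (cong spokeᵇ (sym (letter-before i (suc d)))) (off d ≤-refl)))

    phase-step : ∀ {phase} → NextPhase phase → ∀ i d → stateAt F (before i + 1) ≡ phase 0 →
                 Consecutive M i d →
                 ∃₂ λ l t → Step (phase d) l t × spokeᵇ l ≡ true
    phase-step next i d initial (_ , _ , on , off) = _ , _ ,
      subst (λ s → Step s (F (2 + (before i + suc d))) (stateAt F (1 + (before i + suc d))))
        (phases next i initial d λ m lt → ∉⇒false (off m lt)) (local (before i + suc d)) ,
      trans (cong spokeᵇ (sym (letter-before i (suc d)))) ([]=⇒lookup on)

    spoke-step : ∀ i → spoke i ∈ M →
                 ∃ λ l → Step (stateAt F (before i)) l (stateAt F (before i + 1)) × spokeᵇ l ≡ true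
    spoke-step i on = _ ,
      subst (λ j → Step (stateAt F (before i)) (F (2 + before i)) (stateAt F j))
        (+-comm 1 (before i)) (local (before i)) ,
      trans (cong (λ i → spokeᵇ (letter M i)) (pos-before i)) ([]=⇒lookup on)

    even-gaps : parity (stateAt F k) ≡ false → ∀ i d → Consecutive M i d → d % 4 ≡ 0
    even-gaps even i d c@(_ , on , _)
      with _ , st , now ← spoke-step i on
      with _ , _ , st′ , later ← phase-step evenPhase-next i d
                                  (spoke-even st now (trans (parity-+ (toℕ i)) even)) c
      = evenPhase-spoke d st′ later

    next-spoke : ∀ i → spoke i ∈ M → ∃ λ d → Consecutive M i d
    next-spoke i on
      -- The search succeeds at the latest at `suc k`, where `i ⊕ n` is `i` again; this is the case
      -- of a single spoke.
      with d , d≤ , at-d , before ← least (λ d → M at spoke (i ⊕ suc d)) (suc k)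
             (trans (cong (λ i → M at spoke i) (⊕-n i)) ([]=⇒lookup on))
      = d , s≤s d≤ , on , lookup⇒[]= _ M at-d , λ m lt i → absurd (before m lt) ([]=⇒lookup i)
      where
      absurd : ∀ {b} → b ≡ false → b ≡ true → ⊥
      absurd refl ()

    odd-gap : parity (stateAt F k) ≡ true → ∀ i d → Consecutive M i d → d % 4 ≢ 0
    odd-gap odd i d c@(_ , on , _) d%4
      with _ , st , now ← spoke-step i on
      with divides q refl ← m%n≡0⇒n∣m d 4 d%4
      with _ , _ , st′ , later ← phase-step oddPhase-next i d
                                  (spoke-odd st now (trans (parity-+ (toℕ i)) odd)) c
      = oddPhase-spoke q st′ later

    -- The edges u_iu_{i+2}, v_iv_{i+1} and u_{i+1}u_{i+3} of the first block decide the parity: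
    -- they make the letter `both` with a further u-edge right after it, whereas the odd `both` is
    -- followed by `none`.
    spokeless-even : ∀ (i : Fin n) → M ≡ spokelessMatching i → parity (stateAt F k) ≡ false
    spokeless-even i eq = trans (sym (parity-+ (toℕ i)))
      (precedes (local (before i)) (local (1 + before i)) (value 0F (+-identityʳ _) here₁)
        (value 2F (+-identityʳ _) here₃) (value 0F (+-comm _ 1) here₂))
      where
      positive : 0 < n /ⁿ 4
      positive = m≥n⇒m/n>0 {n} {4} (≤-trans (≤ᵇ⇒≤ 4 11 tt) (s≤s (s≤s 9≤k)))
      here₁ : uu (i ⊕ 0) ∈ M
      here₁ = subst (_ ∈_) (sym eq) (∈-first-⋃ _ (n /ⁿ 4) positive (x∈p∪q⁺ (inj₁ (x∈⁅x⁆ _))))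
      here₂ : uu (i ⊕ 1) ∈ M
      here₂ = subst (_ ∈_) (sym eq) (∈-first-⋃ _ (n /ⁿ 4) positive (x∈p∪q⁺ (inj₂ (x∈p∪q⁺ (inj₁ (x∈⁅x⁆ _))))))
      here₃ : vv (i ⊕ 0) ∈ M
      here₃ = subst (_ ∈_) (sym eq)
        (∈-first-⋃ _ (n /ⁿ 4) positive (x∈p∪q⁺ (inj₂ (x∈p∪q⁺ (inj₂ (x∈p∪q⁺ (inj₁ (x∈⁅x⁆ _))))))))
      value : ∀ (t : Fin 3) {d j} → before i + d ≡ j → combine t (i ⊕ d) ∈ M →
              M at combine t (pos (2 + j)) ≡ true
      value t {d} refl on = trans (cong (λ i → M at combine t i)
        (trans (sym (pos-⊕ (2 + before i) d)) (cong (_⊕ d) (pos-before i)))) ([]=⇒lookup on)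
      precedes : ∀ {s l l′ t t′} → Step s l t → Step t l′ t′ →
                 uuᵇ l ≡ true → vvᵇ l ≡ true → uuᵇ l′ ≡ true → parity s ≡ false
      precedes e₀-both _ _ _ _ = refl
      precedes o₂-both o₃-none _ _ ()

  𝓜₁-even : ∀ {M} → (m : 𝓜₁ n M) → parity (stateAt (letters M) k) ≡ false
  𝓜₁-even {M} m with 𝓜₁.shape m
  ... | inj₂ (_ , _ , i , eq) = spokeless-even (𝓜₁.perfect m) i eq
  ... | inj₁ ((i , on) , gaps) with parity (stateAt (letters M) k) in odd
  ...   | false = refl
  ...   | true with d , c ← next-spoke (𝓜₁.perfect m) i on
          = ⊥-elim (odd-gap (𝓜₁.perfect m) odd i d c (gaps i d c))

  forcing-bound : ∀ {M H} → 𝓜₁ n M → IsForcingSet (P n) M H → 2 + n ≤ 6 * ∥ H ∥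
  forcing-bound {M} {H} m forcing = subst₂ (λ a b → 2 + a ≤ 6 * b)
    (length-tabulate (cellAt H M)) (sym (card-cost H M))
    (even-bounded (cellsOf H M) (𝓜₁-even m)
      (subst (λ w → Walk (stateAt (letters M) k) w (stateAt (letters M) k)) (sym (marks-cells H M))
        (perfect⇒walk M (𝓜₁.perfect m)))
      (All.tabulate⁺ {f = cellAt H M} (⊆⇒⊑ {H} {M} (proj₁ forcing))) (forcing⇒forces {M} {H} forcing)
      (subst (11 ≤_) (sym (length-tabulate (cellAt H M))) (s≤s (s≤s 9≤k))))

  attained : ∀ r m → n ≡ 11 + toℕ {12} r + m * 12 →
             ∃₂ λ M H → 𝓜₁ n M × IsForcingSet (P n) M H × ∥ H ∥ ≡ (18 + toℕ r) /ⁿ 6 + m * 2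
  attained r m size with f , eq ← tabulated {n = n} (optimal r m) (trans (optimal-size r m) (sym size))
    = M , H , record { perfect = perfect ; shape = inj₁ ((0F , spoke₀) , even-gaps perfect even) }
    , forces⇒forcing {M} {H} (⊑⇒⊆ {H} {M} valid) (subst Forces (sym same) (optimal-forces r m))
    , trans (card-cost H M) (trans (cong cost same) (optimal-cost r m))
    where
    M H : Subset (3 * n)
    M = fromLetters (proj₂ ∘ f)
    H = fromLetters (proj₁ ∘ f)

    same : cellsOf H M ≡ optimal r m
    same = trans (tabulate-cong λ i → cong₂ _,_ (letter-fromLetters (proj₁ ∘ f) i)
                                                (letter-fromLetters (proj₂ ∘ f) i)) (sym eq)

    word≡ : word M ≡ marks (optimal r m)
    word≡ = trans (sym (marks-cells H M)) (cong marks same)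

    walk : Walk e₀ (word M) e₀
    walk = subst (λ w → Walk e₀ w e₀) (sym word≡) (optimal-walk r m)

    perfect : PerfectMatching (P n) M
    perfect = walk⇒perfect M (e₀ , walk)

    even : parity (stateAt (letters M) k) ≡ false
    even = cong parity (sym (walk-end (letters M) k (subst (λ w → Walk e₀ w e₀) (word-letters M) walk)))

    spoke₀ : spoke 0F ∈ M
    spoke₀ = lookup⇒[]= (spoke 0F) M (trans (cong spokeᵇ (letter-fromLetters (proj₂ ∘ f) 0F)) (head eq))
      where
      head : optimal r m ≡ tabulate f → spokeᵇ (proj₂ (f 0F)) ≡ true
      head e with f 0F | ∷-injectiveˡ e
      ... | _ | refl = refl

    valid : ∀ i → letter H i ⊑ letter M i
    valid = tabulate⁻ {f = cellAt H M} {g = letter M}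
      (subst₂ (Pointwise Compat) (sym same) (sym word≡) (optimal-valid r m))

-- The ceiling and the conclusion

open import Data.Integer using (+_; ∣_∣)
open import Data.Rational.Unnormalised using (ceiling; _/_)
import Data.Integer as ℤ
import Data.Integer.Properties as ℤ

⌈_/6⌉ : ℕ → ℕ
⌈ m /6⌉ = ∣ ceiling ((+ m) / 6) ∣

-- The ceiling is the negated floor of the negated fraction, and integer division of a negative
-- numerator splits on the remainder: an exact quotient, or the successor of the rounded-down one.
ceiling-bounds : ∀ p → suc p ≤ 6 * ⌈ suc p /6⌉ × 6 * ⌈ suc p /6⌉ ≤ suc p + 5
ceiling-bounds p rewrite ℤ.∣-i∣≡∣i∣ (+ 1 ℤ.* (ℤ.-[1+ p ] ℤ./ℕ 6)) | ℤ.*-identityˡ (ℤ.-[1+ p ] ℤ./ℕ 6)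
  with suc p % 6 in eq | m≡m%n+[m/n]*n (suc p) 6 | m%n<n (suc p) 6
... | zero  | e | _ rewrite ℤ.∣-i∣≡∣i∣ (+ (suc p /ⁿ 6)) =
  ≤-reflexive eq′ , ≤-trans (≤-reflexive (sym eq′)) (m≤m+n (suc p) 5)
  where
  eq′ : suc p ≡ 6 * (suc p /ⁿ 6)
  eq′ = trans e (*-comm (suc p /ⁿ 6) 6)
... | suc r | e | lt = upper , lower
  where
  q = suc p /ⁿ 6
  upper : suc p ≤ 6 * suc q
  upper = begin
    suc p         ≡⟨ e ⟩
    suc r + q * 6 ≤⟨ +-monoˡ-≤ (q * 6) (<⇒≤ lt) ⟩
    suc q * 6     ≡⟨ *-comm (suc q) 6 ⟩
    6 * suc q     ∎
    where open ≤-Reasoning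
  lower : 6 * suc q ≤ suc p + 5
  lower = begin
    6 * suc q             ≡⟨ *-comm 6 (suc q) ⟩
    6 + q * 6             ≡⟨ cong (_+ q * 6) (+-comm 1 5) ⟩
    (5 + 1) + q * 6       ≤⟨ +-monoˡ-≤ (q * 6) (+-monoʳ-≤ 5 (s≤s (z≤n {r}))) ⟩
    (5 + suc r) + q * 6   ≡⟨ +-assoc 5 (suc r) (q * 6) ⟩
    5 + (suc r + q * 6)   ≡⟨ cong (λ x → 5 + x) e ⟨
    5 + suc p             ≡⟨ +-comm 5 (suc p) ⟩
    suc p + 5             ∎
    where open ≤-Reasoning

-- Used with m = n + 2 in both directions: `a` is the ceiling and `b` the size of a forcing set for
-- the lower bound, and the other way round for attainment.
≤-by-sixfold : ∀ {a b m} → 6 * a ≤ m + 5 → m ≤ 6 * b → a ≤ b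
≤-by-sixfold {a} {b} {m} x y = ≮⇒≥ λ b<a → <-irrefl refl (begin-strict
  m + 5     ≤⟨ +-monoˡ-≤ 5 y ⟩
  6 * b + 5 <⟨ +-monoʳ-< (6 * b) (n<1+n 5) ⟩
  6 * b + 6 ≡⟨ trans (+-comm (6 * b) 6) (sym (*-suc 6 b)) ⟩
  6 * suc b ≤⟨ *-monoʳ-≤ 6 b<a ⟩
  6 * a     ≤⟨ x ⟩
  m + 5     ∎)
  where open ≤-Reasoning

theorem3p2 : ∀ n → 11 ≤ n →
    IsMinimum (λ k → ∃ λ M → 𝓜₁ n M × IsForcingNumber (P n) M k)
    ∣ ceiling ((+ (n + 2)) / 6) ∣
theorem3p2 (suc (suc k)) 11≤n@(s≤s (s≤s 9≤k)) = existence , minimal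
  where
  open Shape k 9≤k

  c : ℕ
  c = ⌈ n + 2 /6⌉

  bounds : n + 2 ≤ 6 * c × 6 * c ≤ (n + 2) + 5
  bounds = ceiling-bounds (1 + (k + 2))

  lower : ∀ {M H} → 𝓜₁ n M → IsForcingSet (P n) M H → c ≤ ∥ H ∥
  lower m forcing = ≤-by-sixfold {m = n + 2} (proj₂ bounds)
    (≤-trans (≤-reflexive (+-comm n 2)) (forcing-bound m forcing))

  minimal : ∀ x → (∃ λ M → 𝓜₁ n M × IsForcingNumber (P n) M x) → c ≤ x
  minimal x (M , m , ((H , forcing , refl) , _)) = lower m forcing

  r : Fin 12
  r = (n ∸ 11) mod 12
  q : ℕ
  q = (n ∸ 11) /ⁿ 12

  n≡ : n ≡ 11 + toℕ r + q * 12
  n≡ = begin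
    n                                 ≡⟨ m+[n∸m]≡n 11≤n ⟨
    11 + (n ∸ 11)                     ≡⟨ cong (λ a → 11 + a) (m≡m%n+[m/n]*n (n ∸ 11) 12) ⟩
    11 + ((n ∸ 11) % 12 + q * 12)     ≡⟨ cong (λ a → 11 + (a + q * 12)) (toℕ-fromℕ< (m%n<n (n ∸ 11) 12)) ⟨
    11 + (toℕ r + q * 12)             ≡⟨ +-assoc 11 (toℕ r) (q * 12) ⟨
    11 + toℕ r + q * 12               ∎
    where
    open ≡-Reasoning

  existence : ∃ λ M → 𝓜₁ n M × IsForcingNumber (P n) M c
  existence = optimum (attained r q n≡)
    where
    optimum : (∃₂ λ M H → 𝓜₁ n M × IsForcingSet (P n) M H × ∥ H ∥ ≡ (18 + toℕ r) /ⁿ 6 + q * 2) →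
              ∃ λ M → 𝓜₁ n M × IsForcingNumber (P n) M c
    optimum (M , H , m , forcing , card) = M , m
      , (H , forcing , ≤-antisym (≤-by-sixfold {m = n + 2} small (proj₁ bounds)) (lower m forcing))
      , λ { x (H′ , forcing′ , refl) → lower m forcing′ }
      where
      small : 6 * ∥ H ∥ ≤ (n + 2) + 5
      small = begin
        6 * ∥ H ∥                             ≡⟨ cong (6 *_) card ⟩
        6 * ((18 + toℕ r) /ⁿ 6 + q * 2)        ≡⟨ *-distribˡ-+ 6 ((18 + toℕ r) /ⁿ 6) (q * 2) ⟩
        6 * ((18 + toℕ r) /ⁿ 6) + 6 * (q * 2)  ≡⟨ cong₂ _+_ (*-comm 6 ((18 + toℕ r) /ⁿ 6))
                                                       (solve 1 (λ q → con 6 :* (q :* con 2) := q :* con 12) refl q) ⟩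
        (18 + toℕ r) /ⁿ 6 * 6 + q * 12         ≤⟨ +-monoˡ-≤ (q * 12) (m/n*n≤m (18 + toℕ r) 6) ⟩
        18 + toℕ r + q * 12                   ≡⟨ cong (λ a → 7 + a) n≡ ⟨
        7 + n                                 ≡⟨ +-comm 7 n ⟩
        n + 7                                 ≡⟨ +-assoc n 2 5 ⟨
        (n + 2) + 5                           ∎
        where
        open ≤-Reasoning
        open +-*-Solver
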